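{- Let $n$ be a positive integer. Then \[ \sum_{\gamma \in D_n} (-1)^{\ell_D(\gamma)}q^{\operatorname{Dmaj}(\gamma)}= \begin{cases} [2]_{ -q}[4]_{q}\cdots[2n-2]_{ -q}\,[n]_{q} & \text{if $n$ is even,} \\ [2]_{ -q}[4]_{q}\cdots[2n-2]_{q} \, [n]_{q} & \text{if $n$ is odd,} \end{cases} \] where in both cases the first $n-1$ factors are $[2i]_{(-1)^i q}$ for $i=1,\dots,n-1$.
   Context: For a positive integer $m$, $[m]_q:=\frac{1-q^m}{1-q}=1+q+\dots+q^{m-1}$, and $[m]_{ -q}$ is obtained by substituting $-q$ for $q$. $B_n$ is the group of bijections $\beta$ of $[-n,n]\setminus\{0\}$ with $\beta(-i)=-\beta(i)$, written in window notation $\beta=[\beta_1,\dots,\beta_n]$ with $\beta_i=\beta(i)$. For $\beta\in B_n$: $\operatorname{inv}(\beta)=|\{(i,j): 1\le i<j\le n,\ \beta_i>\beta_j\}|$ (usual order on integers); $\operatorname{N}_1(\beta)=|\{i\in[n]:\beta_i<0\}|$; $\operatorname{N}_2(\beta)=|\{\{i,j\}: i\neq j\in[n],\ \beta_i+\beta_j<0\}|$. The descent set $\operatorname{Des}(\beta)$ is the set of $i\in[n-1]$ with $\beta_i\succ\beta_{i+1}$, where $\prec$ is the total order $-1\prec-2\prec\cdots\prec-n\prec 1\prec 2\prec\cdots\prec n$; $\operatorname{maj}(\beta)=\sum_{i\in\operatorname{Des}(\beta)}i$ and the flag-major index is $\operatorname{fmaj}(\beta)=2\operatorname{maj}(\beta)+\operatorname{N}_1(\beta)$.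 $D_n=\{\gamma\in B_n:\operatorname{N}_1(\gamma)\text{ even}\}$, with Coxeter length $\ell_D(\gamma)=\operatorname{inv}(\gamma)+\operatorname{N}_2(\gamma)$. For $\gamma\in D_n$, let $|\gamma|_n=[\gamma_1,\dots,\gamma_{n-1},|\gamma_n|]\in B_n$ and define the $D$-major index $\operatorname{Dmaj}(\gamma)=\operatorname{fmaj}(|\gamma|_n)$. -}

module Defs where

open import Data.Bool using (Bool; true; false; if_then_else_; _∧_; not)
open import Data.Nat as ℕ using (ℕ; zero; suc)
import Data.Nat.Properties as ℕP
open import Data.Integer as ℤ using (ℤ; +_; -[1+_]; ∣_∣)
import Data.Integer.Properties as ℤP
open import Data.List using (List; []; _∷_; map; concatMap; foldr; upTo; _++_)
open import Relation.Nullary.Decidable using (⌊_⌋)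
open import Relation.Binary.PropositionalEquality using (_≡_)

-- Polynomials in q with integer coefficients, as coefficient lists
-- (constant term first).  Equality is coefficientwise.

Poly : Set
Poly = List ℤ

coeff : Poly → ℕ → ℤ
coeff []       _       = + 0
coeff (c ∷ p)  zero    = c
coeff (c ∷ p)  (suc k) = coeff p k

infix 4 _≈ₚ_
_≈ₚ_ : Poly → Poly → Set
p ≈ₚ r = (k : ℕ) → coeff p k ≡ coeff r k

infixl 6 _+ₚ_
_+ₚ_ : Poly → Poly → Poly
[]      +ₚ r       = r
(c ∷ p) +ₚ []      = c ∷ p
(c ∷ p) +ₚ (d ∷ r) = (c ℤ.+ d) ∷ (p +ₚ r)

scaleₚ : ℤ → Poly → Poly
scaleₚ c p = map (c ℤ.*_) p

infixl 7 _*ₚ_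
_*ₚ_ : Poly → Poly → Poly
[]      *ₚ r = []
(c ∷ p) *ₚ r = scaleₚ c r +ₚ (+ 0 ∷ (p *ₚ r))

monomial : ℤ → ℕ → Poly
monomial c zero    = c ∷ []
monomial c (suc k) = + 0 ∷ monomial c k

sumₚ : List Poly → Poly
sumₚ = foldr _+ₚ_ []

prodₚ : List Poly → Poly
prodₚ = foldr _*ₚ_ (+ 1 ∷ [])

sgn : ℕ → ℤ
sgn zero    = + 1
sgn (suc k) = ℤ.- sgn k

-- [m]_{s q} = 1 + (s q) + ... + (s q)^{m-1}, for a sign s = (-1)^e
qInt : ℕ → ℕ → Poly
qInt m e = sumₚ (map (λ j → monomial (sgn (e ℕ.* j)) j) (upTo m))

[_]q : ℕ → Poly
[ m ]q = qInt m 0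

-- Signed permutations in window notation, as lists of integers.

words : {A : Set} → List A → ℕ → List (List A)
words alph zero    = [] ∷ []
words alph (suc k) = concatMap (λ a → map (a ∷_) (words alph k)) alph

alphabet : ℕ → List ℤ
alphabet n = map (λ i → + suc i) (upTo n) ++ map (λ i → -[1+ i ]) (upTo n)

bfilter : {A : Set} → (A → Bool) → List A → List A
bfilter p []      = []
bfilter p (x ∷ w) = if p x then x ∷ bfilter p w else bfilter p w

anyB : {A : Set} → (A → Bool) → List A → Bool
anyB p []      = false
anyB p (x ∷ w) = if p x then true else anyB p w

countB : {A : Set} → (A → Bool) → List A → ℕ
countB p []      = 0
countB p (x ∷ w) = if p x then suc (countB p w) else countB p w

distinctAbs : List ℤ → Bool
distinctAbs []      = true
distinctAbs (x ∷ w) = not (anyB (λ y → ⌊ ∣ x ∣ ℕ.≟ ∣ y ∣ ⌋) w) ∧ distinctAbs w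

-- B_n: windows [β_1,…,β_n] with entries in [-n,n]\{0} and pairwise
-- distinct absolute values (i.e. exactly the signed permutations of [n]).
Bn : ℕ → List (List ℤ)
Bn n = bfilter distinctAbs (words (alphabet n) n)

isNeg : ℤ → Bool
isNeg x = ⌊ x ℤ.<? + 0 ⌋

N₁ : List ℤ → ℕ
N₁ = countB isNeg

even? : ℕ → Bool
even? zero          = true
even? (suc zero)    = false
even? (suc (suc k)) = even? k

Dn : ℕ → List (List ℤ)
Dn n = bfilter (λ w → even? (N₁ w)) (Bn n)

pairCount : (ℤ → ℤ → Bool) → List ℤ → ℕ
pairCount R []      = 0
pairCount R (x ∷ w) = countB (R x) w ℕ.+ pairCount R w

inv : List ℤ → ℕ
inv = pairCount (λ a b → ⌊ b ℤ.<? a ⌋)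

N₂ : List ℤ → ℕ
N₂ = pairCount (λ a b → isNeg (a ℤ.+ b))

-- Coxeter length in D_n
ℓD : List ℤ → ℕ
ℓD w = inv w ℕ.+ N₂ w

-- a ≻ b in the order -1 ≺ -2 ≺ ⋯ ≺ -n ≺ 1 ≺ 2 ≺ ⋯ ≺ n
-- (negatives first, ordered by increasing absolute value; then positives)
succOrd : ℤ → ℤ → Bool
succOrd a b with isNeg a | isNeg b
... | true  | true  = ⌊ ∣ b ∣ ℕ.<? ∣ a ∣ ⌋
... | true  | false = false
... | false | true  = true
... | false | false = ⌊ b ℤ.<? a ⌋

majFrom : ℕ → List ℤ → ℕ
majFrom i []           = 0
majFrom i (x ∷ [])     = 0
majFrom i (x ∷ y ∷ w)  = (if succOrd x y then i else 0) ℕ.+ majFrom (suc i) (y ∷ w)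

maj : List ℤ → ℕ
maj = majFrom 1

fmaj : List ℤ → ℕ
fmaj w = 2 ℕ.* maj w ℕ.+ N₁ w

absLast : List ℤ → List ℤ
absLast []          = []
absLast (x ∷ [])    = + ∣ x ∣ ∷ []
absLast (x ∷ y ∷ w) = x ∷ absLast (y ∷ w)

Dmaj : List ℤ → ℕ
Dmaj w = fmaj (absLast w)

lhs : ℕ → Poly
lhs n = sumₚ (map (λ g → monomial (sgn (ℓD g)) (Dmaj g)) (Dn n))

rhs : ℕ → Poly
rhs n = prodₚ (map (λ i → qInt (2 ℕ.* suc i) (suc i)) (upTo (n ℕ.∸ 1))) *ₚ [ n ]q

{-# OPTIONS --safe #-}
module Submission where

-- Modulo 2, ℓD counts the inversions of the word of absolute values, so it only depends
-- on |γ|_n, and γ ↦ |γ|_n maps D_n bijectively onto the signed permutations with positive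
-- last letter.  Stepping all letters of a signed permutation down cyclically in the order
-- ≺ raises fmaj by one as long as the last letter is not the least, and multiplies the sign
-- by (-1)^(n-1).  Hence every element of B_n is obtained exactly once by applying k < 2n
-- such steps to a signed permutation ending in n, and its last letter is positive iff
-- k < n.  This yields ∏_{i<n} [2i]_{(-1)^(i-1) q} · [n]_{(-1)^(n-1) q}, and since
-- [2i]_{±q} = (1 ± q)[i]_{q²} the signs may be exchanged between pairs of factors.

-- Under a rotation of B_n only the letter of absolute value 1 wraps around. All other letters keep
-- their signs and mutual comparisons, so the statistics change only through that letter. If it is
-- 1, it becomes -n: its place in ≺ relative to the others is unchanged and N₁ grows by one. If it
-- is -1, it becomes n: N₁ drops by one, while a descent moves one place to the right (or appears at
-- position 1), and 2 - 1 = 1. The last position is excluded because nothing lies to its right. In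
-- absolute values the least entry becomes the greatest, so its n - 1 pairs all switch between
-- inversion and non-inversion, whence (-1)^(n-1). The last letter counts the rotations: n has rank
-- 2n - 1 in ≺, and each step lowers the rank by one. Deleting a final n changes neither inversions
-- nor descents, which gives the recursion over B_(n-1). The signs obtained this way are opposite to
-- those wanted; consecutive factors are exchanged in pairs, and for even n the factor left over is
-- paired with [n]_{±q}, which then has an even number of terms.

open import Defs
open import Algebra.Bundles using (CommutativeMonoid; CommutativeSemiring)
open import Algebra.Structures using (IsCommutativeMonoid)
open import Algebra.Structures.Biased using (isCommutativeSemiringˡ)
open import Data.Bool as Bool using (Bool; true; false; if_then_else_; not; _∧_)
open import Data.Fin using (Fin; zero; suc; fromℕ<; toℕ)
import Data.Fin.Properties as FinP
open import Data.Integer as ℤ using (ℤ; +_; -[1+_]; ∣_∣)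
import Data.Integer.Properties as ℤP
open import Algebra.Properties.CommutativeSemigroup ℤP.*-commutativeSemigroup using () renaming (interchange to *-interchange)
import Data.Integer.Tactic.RingSolver as ℤSolver
open import Data.List using (List; []; _∷_; _∷ʳ_; map; _++_; length; lookup; last; upTo;
  filter; concatMap; cartesianProduct; cartesianProductWith; initLast; _∷ʳ′_)
import Data.List.Properties as LP
open import Data.List.Membership.Propositional using (_∈_)
open import Data.List.Membership.Propositional.Properties
  using (∈-lookup; ∈-map⁺; ∈-map⁻; ∈-++⁺ˡ; ∈-++⁺ʳ; ∈-++⁻; ∈-upTo⁺; ∈-upTo⁻; ∈-filter⁺; ∈-filter⁻;
         ∈-cartesianProduct⁺; ∈-cartesianProduct⁻; ∈-cartesianProductWith⁺; ∈-cartesianProductWith⁻)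
open import Data.List.Membership.Propositional.Properties.WithK using (unique∧set⇒bag)
open import Data.List.Relation.Binary.BagAndSetEquality using (∼bag⇒↭)
open import Data.List.Relation.Binary.Permutation.Propositional as Perm using (_↭_)
open import Data.List.Relation.Unary.All as All using (All; []; _∷_)
import Data.List.Relation.Unary.All.Properties as AllP
open import Data.List.Relation.Unary.AllPairs using (AllPairs; []; _∷_)
open import Data.List.Relation.Unary.Any using (here; there)
open import Data.List.Relation.Unary.Unique.Propositional using (Unique)
import Data.List.Relation.Unary.Unique.Propositional.Properties as UniqueP
open import Data.Maybe using (just)
open import Data.Maybe.Properties using (just-injective)
open import Data.Nat as ℕ using (ℕ; zero; suc; _≤_; _<_; z≤n; s≤s)
open import Data.Nat.GeneralisedArithmetic using (fold)
import Data.Nat.Properties as ℕP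
open import Data.Nat.Tactic.RingSolver using (solve-∀)
open import Data.Product using (_×_; _,_; proj₁; proj₂; ∃)
open import Data.Sum using (_⊎_; inj₁; inj₂)
open import Function using (_∘_; id; mk⇔)
open import Level using (0ℓ)
open import Relation.Binary using (IsEquivalence; tri<; tri≈; tri>)
open import Relation.Binary.PropositionalEquality using (_≡_; _≢_; refl; sym; trans; cong; cong₂; subst; module ≡-Reasoning)
import Relation.Binary.Reasoning.Setoid as SetoidReasoning
open import Relation.Nullary using (Dec; does; yes; no; contradiction)
open import Relation.Nullary.Decidable using (⌊_⌋; isYes≗does; dec-true; dec-false)

-- The semiring of polynomials

-- _≈ₚ_ as a record: its two sides can then be inferred by unification.
infix 4 _≋_
record _≋_ (p r : Poly) : Set where
  constructor coeffwise
  field coeff-≡ : p ≈ₚ r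
open _≋_

≋-refl : ∀ {p} → p ≋ p
≋-refl = coeffwise λ _ → refl

≋-sym : ∀ {p r} → p ≋ r → r ≋ p
≋-sym e = coeffwise λ k → sym (coeff-≡ e k)

≋-trans : ∀ {p r s} → p ≋ r → r ≋ s → p ≋ s
≋-trans e f = coeffwise λ k → trans (coeff-≡ e k) (coeff-≡ f k)

≋-reflexive : ∀ {p r} → p ≡ r → p ≋ r
≋-reflexive refl = ≋-refl

≋-isEquivalence : IsEquivalence _≋_
≋-isEquivalence = record { refl = ≋-refl ; sym = ≋-sym ; trans = ≋-trans }

∷-cong : ∀ {c d p r} → c ≡ d → p ≋ r → c ∷ p ≋ d ∷ r
∷-cong c≡d e = coeffwise λ { zero → c≡d ; (suc k) → coeff-≡ e k }

-- A polynomial has many coefficient lists, differing by trailing zeros; the recursion for `_*ₚ_`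
-- produces them.
0∷[] : + 0 ∷ [] ≋ []
0∷[] = coeffwise λ { zero → refl ; (suc _) → refl }

coeff-+ : ∀ p r k → coeff (p +ₚ r) k ≡ coeff p k ℤ.+ coeff r k
coeff-+ []      r       k       = sym (ℤP.+-identityˡ _)
coeff-+ (c ∷ p) []      k       = sym (ℤP.+-identityʳ _)
coeff-+ (c ∷ p) (d ∷ r) zero    = refl
coeff-+ (c ∷ p) (d ∷ r) (suc k) = coeff-+ p r k

coeff-scale : ∀ c p k → coeff (scaleₚ c p) k ≡ c ℤ.* coeff p k
coeff-scale c []      k       = sym (ℤP.*-zeroʳ c)
coeff-scale c (d ∷ p) zero    = refl
coeff-scale c (d ∷ p) (suc k) = coeff-scale c p k

+ₚ-cong : ∀ {p p′ r r′} → p ≋ p′ → r ≋ r′ → p +ₚ r ≋ p′ +ₚ r′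
+ₚ-cong {p} {p′} {r} {r′} e f = coeffwise λ k → begin
  coeff (p +ₚ r) k           ≡⟨ coeff-+ p r k ⟩
  coeff p k ℤ.+ coeff r k    ≡⟨ cong₂ ℤ._+_ (coeff-≡ e k) (coeff-≡ f k) ⟩
  coeff p′ k ℤ.+ coeff r′ k  ≡⟨ coeff-+ p′ r′ k ⟨
  coeff (p′ +ₚ r′) k         ∎
  where open ≡-Reasoning

+ₚ-comm : ∀ p r → p +ₚ r ≋ r +ₚ p
+ₚ-comm p r = coeffwise λ k → begin
  coeff (p +ₚ r) k         ≡⟨ coeff-+ p r k ⟩
  coeff p k ℤ.+ coeff r k  ≡⟨ ℤP.+-comm (coeff p k) (coeff r k) ⟩
  coeff r k ℤ.+ coeff p k  ≡⟨ coeff-+ r p k ⟨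
  coeff (r +ₚ p) k         ∎
  where open ≡-Reasoning

+ₚ-assoc : ∀ p r s → (p +ₚ r) +ₚ s ≋ p +ₚ (r +ₚ s)
+ₚ-assoc []      r       s       = ≋-refl
+ₚ-assoc (c ∷ p) []      s       = ≋-refl
+ₚ-assoc (c ∷ p) (d ∷ r) []      = ≋-refl
+ₚ-assoc (c ∷ p) (d ∷ r) (e ∷ s) = ∷-cong (ℤP.+-assoc c d e) (+ₚ-assoc p r s)

+ₚ-isCommutativeMonoid : IsCommutativeMonoid _≋_ _+ₚ_ []
+ₚ-isCommutativeMonoid = record
  { isMonoid = record
    { isSemigroup = record
      { isMagma = record { isEquivalence = ≋-isEquivalence ; ∙-cong = +ₚ-cong }
      ; assoc   = +ₚ-assoc
      }
    ; identity = (λ _ → ≋-refl) , λ p → +ₚ-comm p []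
    }
  ; comm = +ₚ-comm
  }

+ₚ-commutativeMonoid : CommutativeMonoid 0ℓ 0ℓ
+ₚ-commutativeMonoid = record { isCommutativeMonoid = +ₚ-isCommutativeMonoid }

open import Algebra.Properties.CommutativeSemigroup (CommutativeMonoid.commutativeSemigroup +ₚ-commutativeMonoid)
  using () renaming (interchange to +ₚ-interchange; x∙yz≈y∙xz to +ₚ-leftComm)

scale-cong : ∀ c {p r} → p ≋ r → scaleₚ c p ≋ scaleₚ c r
scale-cong c {p} {r} e = coeffwise λ k → begin
  coeff (scaleₚ c p) k  ≡⟨ coeff-scale c p k ⟩
  c ℤ.* coeff p k       ≡⟨ cong (c ℤ.*_) (coeff-≡ e k) ⟩
  c ℤ.* coeff r k       ≡⟨ coeff-scale c r k ⟨
  coeff (scaleₚ c r) k  ∎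
  where open ≡-Reasoning

scale-+ₚ : ∀ c p r → scaleₚ c (p +ₚ r) ≋ scaleₚ c p +ₚ scaleₚ c r
scale-+ₚ c []      r       = ≋-refl
scale-+ₚ c (d ∷ p) []      = ≋-refl
scale-+ₚ c (d ∷ p) (e ∷ r) = ∷-cong (ℤP.*-distribˡ-+ c d e) (scale-+ₚ c p r)

+-scale : ∀ c d p → scaleₚ (c ℤ.+ d) p ≋ scaleₚ c p +ₚ scaleₚ d p
+-scale c d []      = ≋-refl
+-scale c d (e ∷ p) = ∷-cong (ℤP.*-distribʳ-+ e c d) (+-scale c d p)

*-scale : ∀ c d p → scaleₚ (c ℤ.* d) p ≋ scaleₚ c (scaleₚ d p)
*-scale c d []      = ≋-refl
*-scale c d (e ∷ p) = ∷-cong (ℤP.*-assoc c d e) (*-scale c d p)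

scale-zero : ∀ p → scaleₚ (+ 0) p ≋ []
scale-zero []      = ≋-refl
scale-zero (_ ∷ p) = ≋-trans (∷-cong refl (scale-zero p)) 0∷[]

scale-one : ∀ p → scaleₚ (+ 1) p ≋ p
scale-one []      = ≋-refl
scale-one (c ∷ p) = ∷-cong (ℤP.*-identityˡ c) (scale-one p)

*ₚ-congʳ : ∀ p {r r′} → r ≋ r′ → p *ₚ r ≋ p *ₚ r′
*ₚ-congʳ []      e = ≋-refl
*ₚ-congʳ (c ∷ p) e = +ₚ-cong (scale-cong c e) (∷-cong refl (*ₚ-congʳ p e))

*ₚ-zeroʳ : ∀ p → p *ₚ [] ≋ []
*ₚ-zeroʳ []      = ≋-refl
*ₚ-zeroʳ (c ∷ p) = ≋-trans (∷-cong refl (*ₚ-zeroʳ p)) 0∷[]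

-- The mirror image of the defining equation of `_*ₚ_`, unfolding the right factor; commutativity is
-- then an induction on the left one.
*ₚ-∷ : ∀ p d r → p *ₚ (d ∷ r) ≋ scaleₚ d p +ₚ (+ 0 ∷ p *ₚ r)
*ₚ-∷ []      d r = ≋-sym 0∷[]
*ₚ-∷ (c ∷ p) d r = ∷-cong (cong (ℤ._+ + 0) (ℤP.*-comm c d))
  (≋-trans (+ₚ-cong (≋-refl {scaleₚ c r}) (*ₚ-∷ p d r))
           (+ₚ-leftComm (scaleₚ c r) (scaleₚ d p) (+ 0 ∷ p *ₚ r)))

*ₚ-comm : ∀ p r → p *ₚ r ≋ r *ₚ p
*ₚ-comm []      r = ≋-sym (*ₚ-zeroʳ r)
*ₚ-comm (c ∷ p) r = ≋-trans (+ₚ-cong ≋-refl (∷-cong refl (*ₚ-comm p r))) (≋-sym (*ₚ-∷ r c p))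

-- Since `_*ₚ_` recurses on its left factor, and `≋` relates lists of different lengths, congruence
-- there is reached through commutativity.
*ₚ-cong : ∀ {p p′ r r′} → p ≋ p′ → r ≋ r′ → p *ₚ r ≋ p′ *ₚ r′
*ₚ-cong {p} {p′} {r} {r′} e f =
  ≋-trans (*ₚ-congʳ p f)
  (≋-trans (*ₚ-comm p r′) (≋-trans (*ₚ-congʳ r′ e) (*ₚ-comm r′ p′)))

*ₚ-distribʳ-+ₚ : ∀ s p r → (p +ₚ r) *ₚ s ≋ p *ₚ s +ₚ r *ₚ s
*ₚ-distribʳ-+ₚ s []      r       = ≋-refl
*ₚ-distribʳ-+ₚ s (c ∷ p) []      = +ₚ-comm [] _
*ₚ-distribʳ-+ₚ s (c ∷ p) (d ∷ r) = ≋-trans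
  (+ₚ-cong (+-scale c d s) (∷-cong (refl {x = + 0}) (*ₚ-distribʳ-+ₚ s p r)))
  (+ₚ-interchange (scaleₚ c s) (scaleₚ d s) (+ 0 ∷ p *ₚ s) (+ 0 ∷ r *ₚ s))

scale-*ₚ : ∀ c p r → scaleₚ c p *ₚ r ≋ scaleₚ c (p *ₚ r)
scale-*ₚ c []      r = ≋-refl
scale-*ₚ c (d ∷ p) r = ≋-trans
  (+ₚ-cong (*-scale c d r) (∷-cong (sym (ℤP.*-zeroʳ c)) (scale-*ₚ c p r)))
  (≋-sym (scale-+ₚ c (scaleₚ d r) (+ 0 ∷ p *ₚ r)))

shift-*ₚ : ∀ p r → (+ 0 ∷ p) *ₚ r ≋ + 0 ∷ p *ₚ r
shift-*ₚ p r = +ₚ-cong (scale-zero r) ≋-refl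

*ₚ-assoc : ∀ p r s → (p *ₚ r) *ₚ s ≋ p *ₚ (r *ₚ s)
*ₚ-assoc []      r s = ≋-refl
*ₚ-assoc (c ∷ p) r s = ≋-trans (*ₚ-distribʳ-+ₚ s (scaleₚ c r) (+ 0 ∷ p *ₚ r))
  (+ₚ-cong (scale-*ₚ c r s)
           (≋-trans (shift-*ₚ (p *ₚ r) s) (∷-cong refl (*ₚ-assoc p r s))))

*ₚ-identityˡ : ∀ p → (+ 1 ∷ []) *ₚ p ≋ p
*ₚ-identityˡ p = ≋-trans (+ₚ-cong (scale-one p) 0∷[]) (+ₚ-comm p [])

*ₚ-identityʳ : ∀ p → p *ₚ (+ 1 ∷ []) ≋ p
*ₚ-identityʳ p = ≋-trans (*ₚ-comm p _) (*ₚ-identityˡ p)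

+ₚ-*ₚ-commutativeSemiring : CommutativeSemiring 0ℓ 0ℓ
+ₚ-*ₚ-commutativeSemiring = record
  { isCommutativeSemiring = isCommutativeSemiringˡ record
    { +-isCommutativeMonoid = +ₚ-isCommutativeMonoid
    ; *-isCommutativeMonoid = record
      { isMonoid = record
        { isSemigroup = record
          { isMagma = record { isEquivalence = ≋-isEquivalence ; ∙-cong = *ₚ-cong }
          ; assoc   = *ₚ-assoc
          }
        ; identity = *ₚ-identityˡ , *ₚ-identityʳ
        }
      ; comm = *ₚ-comm
      }
    ; distribʳ = *ₚ-distribʳ-+ₚ
    ; zeroˡ    = λ _ → ≋-refl
    }
  }

module Pₚ = CommutativeSemiring +ₚ-*ₚ-commutativeSemiring
module ≋-Reasoning = SetoidReasoning Pₚ.setoid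
open import Algebra.Properties.CommutativeSemigroup Pₚ.*-commutativeSemigroup
  using () renaming (interchange to *ₚ-interchange)

scale-monomial : ∀ c d k → scaleₚ c (monomial d k) ≋ monomial (c ℤ.* d) k
scale-monomial c d zero    = ≋-refl
scale-monomial c d (suc k) = ∷-cong (ℤP.*-zeroʳ c) (scale-monomial c d k)

monomial-* : ∀ c d i j → monomial c i *ₚ monomial d j ≋ monomial (c ℤ.* d) (i ℕ.+ j)
monomial-* c d zero    j = ≋-trans (+ₚ-cong (scale-monomial c d j) 0∷[]) (+ₚ-comm _ [])
monomial-* c d (suc i) j = ≋-trans (shift-*ₚ (monomial c i) (monomial d j)) (∷-cong refl (monomial-* c d i j))

-- Finite sums

module _ {A : Set} where

  ∑ : List A → (A → Poly) → Poly
  ∑ xs f = sumₚ (map f xs)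

  ∑-cong : ∀ {f g : A → Poly} xs → (∀ {x} → x ∈ xs → f x ≋ g x) → ∑ xs f ≋ ∑ xs g
  ∑-cong []       e = ≋-refl
  ∑-cong (x ∷ xs) e = +ₚ-cong (e (here refl)) (∑-cong xs (e ∘ there))

  ∑-↭ : ∀ {xs ys} (f : A → Poly) → xs ↭ ys → ∑ xs f ≋ ∑ ys f
  ∑-↭ f Perm.refl         = ≋-refl
  ∑-↭ f (Perm.prep x p)   = +ₚ-cong ≋-refl (∑-↭ f p)
  ∑-↭ f (Perm.swap x y p) = ≋-trans (+ₚ-cong (≋-refl {f x}) (+ₚ-cong (≋-refl {f y}) (∑-↭ f p))) (+ₚ-leftComm (f x) (f y) _)
  ∑-↭ f (Perm.trans p p′) = ≋-trans (∑-↭ f p) (∑-↭ f p′)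

  ∑-++ : ∀ (f : A → Poly) xs ys → ∑ (xs ++ ys) f ≋ ∑ xs f +ₚ ∑ ys f
  ∑-++ f []       ys = ≋-refl
  ∑-++ f (x ∷ xs) ys = ≋-trans (+ₚ-cong ≋-refl (∑-++ f xs ys)) (≋-sym (+ₚ-assoc (f x) (∑ xs f) (∑ ys f)))

  ∑-*ˡ : ∀ p (f : A → Poly) xs → ∑ xs (λ x → p *ₚ f x) ≋ p *ₚ ∑ xs f
  ∑-*ˡ p f []       = ≋-sym (*ₚ-zeroʳ p)
  ∑-*ˡ p f (x ∷ xs) = ≋-trans (+ₚ-cong ≋-refl (∑-*ˡ p f xs)) (≋-sym (Pₚ.distribˡ p (f x) (∑ xs f)))

∑-cartesianProduct : ∀ {A B : Set} (f : A → Poly) (g : B → Poly) xs ys →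
  ∑ (cartesianProduct xs ys) (λ (x , y) → f x *ₚ g y) ≋ ∑ xs f *ₚ ∑ ys g
∑-cartesianProduct f g []       ys = ≋-refl
∑-cartesianProduct f g (x ∷ xs) ys = begin
  ∑ (map (x ,_) ys ++ cartesianProduct xs ys) h
    ≈⟨ ∑-++ h (map (x ,_) ys) _ ⟩
  ∑ (map (x ,_) ys) h +ₚ ∑ (cartesianProduct xs ys) h
    ≡⟨ cong (λ l → sumₚ l +ₚ ∑ (cartesianProduct xs ys) h) (LP.map-∘ ys) ⟨
  ∑ ys (λ y → f x *ₚ g y) +ₚ ∑ (cartesianProduct xs ys) h
    ≈⟨ +ₚ-cong (∑-*ˡ (f x) g ys) (∑-cartesianProduct f g xs ys) ⟩
  f x *ₚ ∑ ys g +ₚ ∑ xs f *ₚ ∑ ys g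
    ≈⟨ *ₚ-distribʳ-+ₚ (∑ ys g) (f x) (∑ xs f) ⟨
  (f x +ₚ ∑ xs f) *ₚ ∑ ys g ∎
  where
  open ≋-Reasoning
  h = λ ((x , y) : _ × _) → f x *ₚ g y

prod-∷ʳ : ∀ ps p → prodₚ (ps ∷ʳ p) ≋ prodₚ ps *ₚ p
prod-∷ʳ []       p = *ₚ-comm p _
prod-∷ʳ (r ∷ ps) p = ≋-trans (*ₚ-congʳ r (prod-∷ʳ ps p)) (≋-sym (*ₚ-assoc r (prodₚ ps) p))

-- Signs and q-integers

sgn-+ : ∀ a b → sgn (a ℕ.+ b) ≡ sgn a ℤ.* sgn b
sgn-+ zero    b = sym (ℤP.*-identityˡ _)
sgn-+ (suc a) b = trans (cong ℤ.-_ (sgn-+ a b)) (ℤP.neg-distribˡ-* (sgn a) (sgn b))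

sgn-2* : ∀ a → sgn (2 ℕ.* a) ≡ + 1
sgn-2* zero = refl
sgn-2* (suc a) = trans (cong sgn (ℕP.*-suc 2 a)) (trans (ℤP.neg-involutive _) (sgn-2* a))

qInt-suc : ∀ m e → qInt (suc m) e ≋ qInt m e +ₚ monomial (sgn (e ℕ.* m)) m
qInt-suc m e = begin
  ∑ (upTo (suc m)) f        ≡⟨ cong (λ l → ∑ l f) (LP.upTo-∷ʳ m) ⟨
  ∑ (upTo m ∷ʳ m) f         ≈⟨ ∑-++ f (upTo m) (m ∷ []) ⟩
  qInt m e +ₚ (f m +ₚ [])   ≈⟨ +ₚ-cong ≋-refl (+ₚ-comm (f m) []) ⟩
  qInt m e +ₚ f m           ∎
  where
  open ≋-Reasoning
  f = λ j → monomial (sgn (e ℕ.* j)) j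

qInt-periodic : ∀ m e → qInt m (2 ℕ.+ e) ≋ qInt m e
qInt-periodic m e = ∑-cong (upTo m) λ {j} _ → ≋-reflexive (cong (λ c → monomial c j) (lem j))
  where
  lem : ∀ j → sgn ((2 ℕ.+ e) ℕ.* j) ≡ sgn (e ℕ.* j)
  lem j = trans (cong sgn (ℕP.*-distribʳ-+ j 2 e)) (trans (sgn-+ (2 ℕ.* j) (e ℕ.* j))
    (trans (cong (ℤ._* sgn (e ℕ.* j)) (sgn-2* j)) (ℤP.*-identityˡ _)))

[_]q² : ℕ → Poly
[ i ]q² = ∑ (upTo i) (λ j → monomial (+ 1) (2 ℕ.* j))

[]q²-suc : ∀ i → [ suc i ]q² ≋ [ i ]q² +ₚ monomial (+ 1) (2 ℕ.* i)
[]q²-suc i = begin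
  ∑ (upTo (suc i)) f        ≡⟨ cong (λ l → ∑ l f) (LP.upTo-∷ʳ i) ⟨
  ∑ (upTo i ∷ʳ i) f         ≈⟨ ∑-++ f (upTo i) (i ∷ []) ⟩
  [ i ]q² +ₚ (f i +ₚ [])    ≈⟨ +ₚ-cong ≋-refl (+ₚ-comm (f i) []) ⟩
  [ i ]q² +ₚ f i            ∎
  where
  open ≋-Reasoning
  f = λ j → monomial (+ 1) (2 ℕ.* j)

qInt-double : ∀ i e → qInt (2 ℕ.* i) e ≋ qInt 2 e *ₚ [ i ]q²
qInt-double zero    e = ≋-sym (*ₚ-zeroʳ (qInt 2 e))
qInt-double (suc i) e = begin
  qInt (2 ℕ.* suc i) e
    ≡⟨ cong (λ m → qInt m e) (ℕP.*-suc 2 i) ⟩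
  qInt (2 ℕ.+ 2 ℕ.* i) e
    ≈⟨ ≋-trans (qInt-suc (suc (2 ℕ.* i)) e) (+ₚ-cong (qInt-suc (2 ℕ.* i) e) ≋-refl) ⟩
  (qInt (2 ℕ.* i) e +ₚ monomial (sgn (e ℕ.* (2 ℕ.* i))) (2 ℕ.* i)) +ₚ monomial (sgn (e ℕ.* suc (2 ℕ.* i))) (suc (2 ℕ.* i))
    ≡⟨ cong₂ (λ c d → (qInt (2 ℕ.* i) e +ₚ monomial c (2 ℕ.* i)) +ₚ monomial d (suc (2 ℕ.* i))) s₀ s₁ ⟩
  -- The products with `+ 1` stay unevaluated to match the right side of `monomial-*`, used in
  -- `tail`.
  (qInt (2 ℕ.* i) e +ₚ monomial (+ 1 ℤ.* + 1) (2 ℕ.* i)) +ₚ monomial (sgn e ℤ.* + 1) (suc (2 ℕ.* i))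
    ≈⟨ +ₚ-assoc (qInt (2 ℕ.* i) e) _ _ ⟩
  qInt (2 ℕ.* i) e +ₚ (monomial (+ 1 ℤ.* + 1) (2 ℕ.* i) +ₚ monomial (sgn e ℤ.* + 1) (suc (2 ℕ.* i)))
    ≈⟨ +ₚ-cong (qInt-double i e) tail ⟩
  qInt 2 e *ₚ [ i ]q² +ₚ qInt 2 e *ₚ q²ⁱ
    ≈⟨ Pₚ.distribˡ (qInt 2 e) [ i ]q² q²ⁱ ⟨
  qInt 2 e *ₚ ([ i ]q² +ₚ q²ⁱ)
    ≈⟨ *ₚ-congʳ (qInt 2 e) ([]q²-suc i) ⟨
  qInt 2 e *ₚ [ suc i ]q² ∎
  where
  open ≋-Reasoning
  q²ⁱ = monomial (+ 1) (2 ℕ.* i)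
  s₀ : sgn (e ℕ.* (2 ℕ.* i)) ≡ + 1
  s₀ = trans (cong sgn (trans (sym (ℕP.*-assoc e 2 i)) (trans (cong (ℕ._* i) (ℕP.*-comm e 2)) (ℕP.*-assoc 2 e i)))) (sgn-2* (e ℕ.* i))
  s₁ : sgn (e ℕ.* suc (2 ℕ.* i)) ≡ sgn e ℤ.* + 1
  s₁ = trans (cong sgn (ℕP.*-suc e (2 ℕ.* i))) (trans (sgn-+ e _) (cong (sgn e ℤ.*_) s₀))
  two : qInt 2 e ≋ monomial (+ 1) 0 +ₚ monomial (sgn e) 1
  two = ∷-cong (cong (λ k → sgn k ℤ.+ + 0) (ℕP.*-zeroʳ e))
    (∷-cong (cong sgn (ℕP.*-identityʳ e)) ≋-refl)
  tail : monomial (+ 1 ℤ.* + 1) (2 ℕ.* i) +ₚ monomial (sgn e ℤ.* + 1) (suc (2 ℕ.* i)) ≋ qInt 2 e *ₚ q²ⁱ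
  tail = begin
    monomial (+ 1 ℤ.* + 1) (2 ℕ.* i) +ₚ monomial (sgn e ℤ.* + 1) (suc (2 ℕ.* i))
      ≈⟨ +ₚ-cong (monomial-* (+ 1) (+ 1) 0 (2 ℕ.* i)) (monomial-* (sgn e) (+ 1) 1 (2 ℕ.* i)) ⟨
    monomial (+ 1) 0 *ₚ q²ⁱ +ₚ monomial (sgn e) 1 *ₚ q²ⁱ
      ≈⟨ *ₚ-distribʳ-+ₚ q²ⁱ (monomial (+ 1) 0) (monomial (sgn e) 1) ⟨
    (monomial (+ 1) 0 +ₚ monomial (sgn e) 1) *ₚ q²ⁱ
      ≈⟨ *ₚ-cong two (≋-refl {q²ⁱ}) ⟨
    qInt 2 e *ₚ q²ⁱ ∎

-- Products of q-integers and the exchange of signs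

∏ : ℕ → (ℕ → Poly) → Poly
∏ m f = prodₚ (map f (upTo m))

∏-suc : ∀ m f → ∏ (suc m) f ≋ ∏ m f *ₚ f m
∏-suc m f = begin
  ∏ (suc m) f                      ≡⟨ cong (λ l → prodₚ (map f l)) (LP.upTo-∷ʳ m) ⟨
  prodₚ (map f (upTo m ∷ʳ m))      ≡⟨ cong prodₚ (LP.map-++ f (upTo m) (m ∷ [])) ⟩
  prodₚ (map f (upTo m) ∷ʳ f m)    ≈⟨ prod-∷ʳ (map f (upTo m)) (f m) ⟩
  ∏ m f *ₚ f m                     ∎
  where open ≋-Reasoning

data Parity : ℕ → Set where
  even : ∀ h → Parity (2 ℕ.* h)
  odd  : ∀ h → Parity (suc (2 ℕ.* h))

parity : ∀ n → Parity n
parity zero = even 0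
parity (suc n) with parity n
... | even h = odd h
... | odd h rewrite sym (ℕP.*-suc 2 h) = even (suc h)

qInt-even : ∀ m h → qInt m (2 ℕ.* h) ≋ qInt m 0
qInt-even m zero    = ≋-refl
qInt-even m (suc h) = ≋-trans (≋-reflexive (cong (qInt m) (ℕP.*-suc 2 h)))
  (≋-trans (qInt-periodic m (2 ℕ.* h)) (qInt-even m h))

qInt-odd : ∀ m h → qInt m (suc (2 ℕ.* h)) ≋ qInt m 1
qInt-odd m zero    = ≋-refl
qInt-odd m (suc h) = ≋-trans (≋-reflexive (cong (λ e → qInt m (suc e)) (ℕP.*-suc 2 h)))
  (≋-trans (qInt-periodic m (suc (2 ℕ.* h))) (qInt-odd m h))

-- The sign is visible only in `qInt 2`; the factors in q² do not see it, so the two `qInt 2` can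
-- trade places.
qInt-exchange : ∀ i j → qInt (2 ℕ.* i) 0 *ₚ qInt (2 ℕ.* j) 1 ≋ qInt (2 ℕ.* i) 1 *ₚ qInt (2 ℕ.* j) 0
qInt-exchange i j = begin
  qInt (2 ℕ.* i) 0 *ₚ qInt (2 ℕ.* j) 1
    ≈⟨ *ₚ-cong (qInt-double i 0) (qInt-double j 1) ⟩
  (qInt 2 0 *ₚ [ i ]q²) *ₚ (qInt 2 1 *ₚ [ j ]q²)
    ≈⟨ *ₚ-interchange (qInt 2 0) [ i ]q² (qInt 2 1) [ j ]q² ⟩
  (qInt 2 0 *ₚ qInt 2 1) *ₚ ([ i ]q² *ₚ [ j ]q²)
    ≈⟨ *ₚ-cong (*ₚ-comm (qInt 2 0) (qInt 2 1)) (≋-refl {[ i ]q² *ₚ [ j ]q²}) ⟩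
  (qInt 2 1 *ₚ qInt 2 0) *ₚ ([ i ]q² *ₚ [ j ]q²)
    ≈⟨ *ₚ-interchange (qInt 2 1) (qInt 2 0) [ i ]q² [ j ]q² ⟩
  (qInt 2 1 *ₚ [ i ]q²) *ₚ (qInt 2 0 *ₚ [ j ]q²)
    ≈⟨ *ₚ-cong (qInt-double i 1) (qInt-double j 0) ⟨
  qInt (2 ℕ.* i) 1 *ₚ qInt (2 ℕ.* j) 0 ∎
  where open ≋-Reasoning

-- `B-factor i` is the contribution of passing from B_i to B_(i+1), whose rotations carry the sign
-- (-1)^i; `D-factor i` is the factor in the theorem, with the opposite sign.
B-factor D-factor : ℕ → Poly
B-factor i = qInt (2 ℕ.* suc i) i
D-factor i = qInt (2 ℕ.* suc i) (suc i)

-- Two consecutive factors have signs +, - on the left and -, + on the right, so each such pair is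
-- one exchange.
∏-even : ∀ h → ∏ (2 ℕ.* h) B-factor ≋ ∏ (2 ℕ.* h) D-factor
∏-even zero = ≋-refl
∏-even (suc h) = begin
  ∏ (2 ℕ.* suc h) B-factor            ≡⟨ cong (λ m → ∏ m B-factor) (ℕP.*-suc 2 h) ⟩
  ∏ (suc (suc m)) B-factor            ≈⟨ two B-factor ⟩
  ∏ m B-factor *ₚ (B-factor m *ₚ B-factor (suc m))
    ≈⟨ *ₚ-cong (∏-even h) (*ₚ-cong (qInt-even (2 ℕ.* suc m) h) (qInt-odd (2 ℕ.* suc (suc m)) h)) ⟩
  ∏ m D-factor *ₚ (qInt (2 ℕ.* suc m) 0 *ₚ qInt (2 ℕ.* suc (suc m)) 1)
    ≈⟨ *ₚ-congʳ (∏ m D-factor) (qInt-exchange (suc m) (suc (suc m))) ⟩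
  ∏ m D-factor *ₚ (qInt (2 ℕ.* suc m) 1 *ₚ qInt (2 ℕ.* suc (suc m)) 0)
    ≈⟨ *ₚ-congʳ (∏ m D-factor) (*ₚ-cong (qInt-odd (2 ℕ.* suc m) h)
         (≋-trans (qInt-periodic (2 ℕ.* suc (suc m)) m) (qInt-even (2 ℕ.* suc (suc m)) h))) ⟨
  ∏ m D-factor *ₚ (D-factor m *ₚ D-factor (suc m)) ≈⟨ two D-factor ⟨
  ∏ (suc (suc m)) D-factor            ≡⟨ cong (λ m → ∏ m D-factor) (ℕP.*-suc 2 h) ⟨
  ∏ (2 ℕ.* suc h) D-factor            ∎
  where
  open ≋-Reasoning
  m = 2 ℕ.* h
  two : ∀ f → ∏ (suc (suc m)) f ≋ ∏ m f *ₚ (f m *ₚ f (suc m))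
  two f = ≋-trans (∏-suc (suc m) f) (≋-trans (*ₚ-cong (∏-suc m f) (≋-refl {f (suc m)})) (*ₚ-assoc (∏ m f) (f m) (f (suc m))))

-- For odd `n` one factor remains unpaired. The last q-integer then has sign - and `suc n` is even,
-- so it serves as the partner in the exchange.
∏-B-factor≋∏-D-factor : ∀ n → ∏ n B-factor *ₚ qInt (suc n) n ≋ ∏ n D-factor *ₚ [ suc n ]q
∏-B-factor≋∏-D-factor n with parity n
... | even h = *ₚ-cong (∏-even h) (qInt-even (suc (2 ℕ.* h)) h)
... | odd h = begin
  ∏ (suc m) B-factor *ₚ qInt (2 ℕ.+ m) (suc m)
    ≈⟨ *ₚ-cong (∏-suc m B-factor) ≋-refl ⟩
  (∏ m B-factor *ₚ B-factor m) *ₚ qInt (2 ℕ.+ m) (suc m)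
    ≈⟨ *ₚ-assoc (∏ m B-factor) (B-factor m) (qInt (2 ℕ.+ m) (suc m)) ⟩
  ∏ m B-factor *ₚ (B-factor m *ₚ qInt (2 ℕ.+ m) (suc m))
    ≈⟨ *ₚ-cong (∏-even h) (*ₚ-cong (qInt-even (2 ℕ.* suc m) h) (≋-trans (qInt-odd (2 ℕ.+ m) h) (len 1))) ⟩
  ∏ m D-factor *ₚ (qInt (2 ℕ.* suc m) 0 *ₚ qInt (2 ℕ.* suc h) 1)
    ≈⟨ *ₚ-congʳ (∏ m D-factor) (qInt-exchange (suc m) (suc h)) ⟩
  ∏ m D-factor *ₚ (qInt (2 ℕ.* suc m) 1 *ₚ qInt (2 ℕ.* suc h) 0)
    ≈⟨ *ₚ-congʳ (∏ m D-factor) (*ₚ-cong (qInt-odd (2 ℕ.* suc m) h) (len 0)) ⟨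
  ∏ m D-factor *ₚ (D-factor m *ₚ [ 2 ℕ.+ m ]q)
    ≈⟨ *ₚ-assoc (∏ m D-factor) (D-factor m) [ 2 ℕ.+ m ]q ⟨
  (∏ m D-factor *ₚ D-factor m) *ₚ [ 2 ℕ.+ m ]q
    ≈⟨ *ₚ-cong (∏-suc m D-factor) ≋-refl ⟨
  ∏ (suc m) D-factor *ₚ [ 2 ℕ.+ m ]q ∎
  where
  open ≋-Reasoning
  m = 2 ℕ.* h
  len : ∀ e → qInt (2 ℕ.+ m) e ≋ qInt (2 ℕ.* suc h) e
  len e = ≋-reflexive (cong (λ k → qInt k e) (sym (ℕP.*-suc 2 h)))

-- Signed permutations

data Letter (n : ℕ) : ℤ → Set where
  pos : ∀ {i} → i < n → Letter n (+ suc i)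
  neg : ∀ {i} → i < n → Letter n -[1+ i ]

DistinctAbs : List ℤ → Set
DistinctAbs = AllPairs (λ x y → ∣ x ∣ ≢ ∣ y ∣)

record IsSigned (n : ℕ) (w : List ℤ) : Set where
  constructor isSigned
  field
    length≡  : length w ≡ n
    letters  : All (Letter n) w
    distinct : DistinctAbs w
open IsSigned

∣∣-lookup-injective : ∀ {w} → DistinctAbs w → ∀ i j → ∣ lookup w i ∣ ≡ ∣ lookup w j ∣ → i ≡ j
∣∣-lookup-injective (_ ∷ _)  zero    zero    _  = refl
∣∣-lookup-injective (x≢ ∷ _) zero    (suc j) eq = contradiction eq (All.lookup x≢ (∈-lookup j))
∣∣-lookup-injective (x≢ ∷ _) (suc i) zero    eq = contradiction (sym eq) (All.lookup x≢ (∈-lookup i))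
∣∣-lookup-injective (_ ∷ d)  (suc i) (suc j) eq = cong suc (∣∣-lookup-injective d i j eq)

-- The absolute values inject the positions of `w` into `Fin n`.
length≤ : ∀ {n w} → All (Letter n) w → DistinctAbs w → length w ≤ n
length≤ {n} {w} ls d = FinP.injective⇒≤ {f = λ i → proj₁ (index (letter i))} λ {i} {j} eq →
  ∣∣-lookup-injective d i j (trans (sym (proj₂ (index (letter i))))
    (trans (cong (suc ∘ toℕ) eq) (proj₂ (index (letter j)))))
  where
  letter : ∀ i → Letter n (lookup w i)
  letter i = All.lookup ls (∈-lookup i)
  index : ∀ {x} → Letter n x → ∃ λ (i : Fin n) → suc (toℕ i) ≡ ∣ x ∣
  index (pos i<n) = fromℕ< i<n , cong suc (FinP.toℕ-fromℕ< i<n)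
  index (neg i<n) = fromℕ< i<n , cong suc (FinP.toℕ-fromℕ< i<n)

AllPairs-∷ʳ⁺ : ∀ {A : Set} {R : A → A → Set} {xs x} → AllPairs R xs → All (λ y → R y x) xs → AllPairs R (xs ∷ʳ x)
AllPairs-∷ʳ⁺ []       []       = [] ∷ []
AllPairs-∷ʳ⁺ (r ∷ rs) (s ∷ ss) = AllP.∷ʳ⁺ r s ∷ AllPairs-∷ʳ⁺ rs ss

AllPairs-∷ʳ⁻ : ∀ {A : Set} {R : A → A → Set} xs {x} → AllPairs R (xs ∷ʳ x) → AllPairs R xs × All (λ y → R y x) xs
AllPairs-∷ʳ⁻ []       _        = [] , []
AllPairs-∷ʳ⁻ (y ∷ xs) (r ∷ rs) =
  let r′ , s = AllP.∷ʳ⁻ r ; rs′ , ss = AllPairs-∷ʳ⁻ xs rs in r′ ∷ rs′ , s ∷ ss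

-- The cyclic rotation of letters

-- One step down in the order -1 ≺ ⋯ ≺ -(m+1) ≺ 1 ≺ ⋯ ≺ m+1, read cyclically.
rotate : ℕ → ℤ → ℤ
rotate m (+ 0)           = + 0
rotate m (+ 1)           = -[1+ m ]
rotate m (+ suc (suc i)) = + suc i
rotate m -[1+ 0 ]        = + suc m
rotate m -[1+ suc i ]    = -[1+ i ]

unrotate : ℕ → ℤ → ℤ
unrotate m (+ 0)     = + 0
unrotate m (+ suc i) with i ℕ.≟ m
... | yes _ = -[1+ 0 ]
... | no _  = + suc (suc i)
unrotate m -[1+ i ]  with i ℕ.≟ m
... | yes _ = + 1
... | no _  = -[1+ suc i ]

-- The maps induced on absolute values. Their existence is what makes rotation respect distinctness
-- of absolute values, which is stronger than distinctness of letters. The value at 0 is a default.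
rotate∣∣ unrotate∣∣ : ℕ → ℕ → ℕ
rotate∣∣ m 0             = 0
rotate∣∣ m 1             = suc m
rotate∣∣ m (suc (suc i)) = suc i
unrotate∣∣ m 0       = 0
unrotate∣∣ m (suc i) with i ℕ.≟ m
... | yes _ = 1
... | no _  = suc (suc i)

∣rotate∣ : ∀ m x → ∣ rotate m x ∣ ≡ rotate∣∣ m ∣ x ∣
∣rotate∣ m (+ 0)           = refl
∣rotate∣ m (+ 1)           = refl
∣rotate∣ m (+ suc (suc i)) = refl
∣rotate∣ m -[1+ 0 ]        = refl
∣rotate∣ m -[1+ suc i ]    = refl

∣unrotate∣ : ∀ m x → ∣ unrotate m x ∣ ≡ unrotate∣∣ m ∣ x ∣
∣unrotate∣ m (+ 0)     = refl
∣unrotate∣ m (+ suc i) with i ℕ.≟ m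
... | yes _ = refl
... | no _  = refl
∣unrotate∣ m -[1+ i ]  with i ℕ.≟ m
... | yes _ = refl
... | no _  = refl

unrotate-rotate : ∀ {m x} → Letter (suc m) x → unrotate m (rotate m x) ≡ x
unrotate-rotate {m} (pos {zero} _) with m ℕ.≟ m
... | yes _  = refl
... | no m≢m = contradiction refl m≢m
unrotate-rotate {m} (neg {zero} _) with m ℕ.≟ m
... | yes _  = refl
... | no m≢m = contradiction refl m≢m
unrotate-rotate {m} (pos {suc i} (s≤s i<m)) with i ℕ.≟ m
... | yes refl = contradiction i<m (ℕP.<-irrefl refl)
... | no _     = refl
unrotate-rotate {m} (neg {suc i} (s≤s i<m)) with i ℕ.≟ m
... | yes refl = contradiction i<m (ℕP.<-irrefl refl)
... | no _     = refl

rotate-unrotate : ∀ {m x} → Letter (suc m) x → rotate m (unrotate m x) ≡ x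
rotate-unrotate {m} (pos {i} _) with i ℕ.≟ m
... | yes refl = refl
... | no _     = refl
rotate-unrotate {m} (neg {i} _) with i ℕ.≟ m
... | yes refl = refl
... | no _     = refl

Letter-rotate : ∀ {m x} → Letter (suc m) x → Letter (suc m) (rotate m x)
Letter-rotate (pos {zero}  _)   = neg ℕP.≤-refl
Letter-rotate (pos {suc i} i<m) = pos (ℕP.<⇒≤ i<m)
Letter-rotate (neg {zero}  _)   = pos ℕP.≤-refl
Letter-rotate (neg {suc i} i<m) = neg (ℕP.<⇒≤ i<m)

Letter-unrotate : ∀ {m x} → Letter (suc m) x → Letter (suc m) (unrotate m x)
Letter-unrotate {m} (pos {i} i≤m) with i ℕ.≟ m
... | yes _  = neg (s≤s z≤n)
... | no i≢m = pos (s≤s (ℕP.≤∧≢⇒< (ℕP.≤-pred i≤m) i≢m))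
Letter-unrotate {m} (neg {i} i≤m) with i ℕ.≟ m
... | yes _  = pos (s≤s z≤n)
... | no i≢m = neg (s≤s (ℕP.≤∧≢⇒< (ℕP.≤-pred i≤m) i≢m))

module _ {n} (f g : ℤ → ℤ) (g∣∣ : ℕ → ℕ)
         (g∘f : ∀ {x} → Letter n x → g (f x) ≡ x) (∣g∣ : ∀ x → ∣ g x ∣ ≡ g∣∣ ∣ x ∣) where

  -- Because the left inverse `g` acts on absolute values alone, equal absolute values after `f` go
  -- back to equal ones before. Used with `f` and `g` being rotation and its inverse, in both roles.
  ∣∣-reflect : ∀ {x y} → Letter n x → Letter n y → ∣ f x ∣ ≡ ∣ f y ∣ → ∣ x ∣ ≡ ∣ y ∣
  ∣∣-reflect {x} {y} lx ly eq = begin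
    ∣ x ∣         ≡⟨ cong ∣_∣ (g∘f lx) ⟨
    ∣ g (f x) ∣   ≡⟨ ∣g∣ (f x) ⟩
    g∣∣ ∣ f x ∣   ≡⟨ cong g∣∣ eq ⟩
    g∣∣ ∣ f y ∣   ≡⟨ ∣g∣ (f y) ⟨
    ∣ g (f y) ∣   ≡⟨ cong ∣_∣ (g∘f ly) ⟩
    ∣ y ∣         ∎
    where open ≡-Reasoning

  distinct-map : ∀ {w} → All (Letter n) w → DistinctAbs w → DistinctAbs (map f w)
  distinct-map []       []       = []
  distinct-map (l ∷ ls) (r ∷ rs) =
    AllP.map⁺ (All.zipWith (λ (l′ , x≢y) → x≢y ∘ ∣∣-reflect l l′) (ls , r)) ∷ distinct-map ls rs

distinct-rotate : ∀ {m w} → All (Letter (suc m)) w → DistinctAbs w → DistinctAbs (map (rotate m) w)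
distinct-rotate {m} = distinct-map (rotate m) (unrotate m) (unrotate∣∣ m) unrotate-rotate (∣unrotate∣ m)

isSigned-rotate : ∀ {m w} → IsSigned (suc m) w → IsSigned (suc m) (map (rotate m) w)
isSigned-rotate {m} {w} (isSigned len ls d) = isSigned
  (trans (LP.length-map (rotate m) w) len)
  (AllP.map⁺ (All.map Letter-rotate ls))
  (distinct-rotate ls d)

isSigned-unrotate : ∀ {m w} → IsSigned (suc m) w → IsSigned (suc m) (map (unrotate m) w)
isSigned-unrotate {m} {w} (isSigned len ls d) = isSigned
  (trans (LP.length-map (unrotate m) w) len)
  (AllP.map⁺ (All.map Letter-unrotate ls))
  (distinct-map (unrotate m) (rotate m) (rotate∣∣ m) rotate-unrotate (∣rotate∣ m) ls d)

-- The position in ≺, counted from 0 at -1 up to 2m+1 at m+1; the value at 0 is a default.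
rank : ℕ → ℤ → ℕ
rank m (+ 0)     = 0
rank m (+ suc i) = suc m ℕ.+ i
rank m -[1+ i ]  = i

rank-injective : ∀ {m x y} → Letter (suc m) x → Letter (suc m) y → rank m x ≡ rank m y → x ≡ y
rank-injective {m} (pos {i} _) (pos {j} _) eq = cong (λ i → + suc i) (ℕP.+-cancelˡ-≡ (suc m) i j eq)
rank-injective {m} (pos {i} _) (neg j<)    eq = contradiction (subst (ℕ._< suc m) (sym eq) j<) (ℕP.m+n≮m (suc m) i)
rank-injective {m} (neg i<)    (pos {j} _) eq = contradiction (subst (ℕ._< suc m) eq i<) (ℕP.m+n≮m (suc m) j)
rank-injective     (neg _)     (neg _)     eq = cong -[1+_] eq

rank-rotate : ∀ {m x r} → Letter (suc m) x → rank m x ≡ suc r → rank m (rotate m x) ≡ r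
rank-rotate {m} (pos {zero}  _) eq   = trans (sym (ℕP.+-identityʳ m)) (ℕP.suc-injective eq)
rank-rotate {m} (pos {suc i} _) eq   = trans (sym (ℕP.+-suc m i)) (ℕP.suc-injective eq)
rank-rotate     (neg {suc i} _) refl = refl

rank-unrotate : ∀ {m x} → Letter (suc m) x → rank m x ≢ suc m ℕ.+ m → rank m (unrotate m x) ≡ suc (rank m x)
rank-unrotate {m} (pos {i} _) ≢top with i ℕ.≟ m
... | yes refl = contradiction refl ≢top
... | no _     = ℕP.+-suc (suc m) i
rank-unrotate {m} (neg {i} _) ≢top with i ℕ.≟ m
... | yes refl = ℕP.+-identityʳ (suc m)
... | no _     = refl

-- Effect of one rotation on the statistics

-- The letters that rotate without wrapping: absolute value between 2 and m+1, lowered by one with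
-- the sign kept.
data Big (m : ℕ) : ℤ → Set where
  pos : ∀ {j} → j < m → Big m (+ suc (suc j))
  neg : ∀ {j} → j < m → Big m -[1+ suc j ]

data OneAt (m : ℕ) (x : ℤ) : List ℤ → Set where
  here  : ∀ {w} → All (Big m) w → OneAt m x (x ∷ w)
  there : ∀ {y w} → Big m y → OneAt m x w → OneAt m x (y ∷ w)

notOne⇒big : ∀ {m x} → 1 ≢ ∣ x ∣ → Letter (suc m) x → Big m x
notOne⇒big 1≢ (pos {zero}  _)         = contradiction refl 1≢
notOne⇒big 1≢ (pos {suc i} (s≤s i<m)) = pos i<m
notOne⇒big 1≢ (neg {zero}  _)         = contradiction refl 1≢
notOne⇒big 1≢ (neg {suc i} (s≤s i<m)) = neg i<m

findOne : ∀ {m w} → All (Letter (suc m)) w → DistinctAbs w →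
          All (Big m) w ⊎ OneAt m (+ 1) w ⊎ OneAt m -[1+ 0 ] w
findOne [] [] = inj₁ []
findOne (pos {zero} _ ∷ ls) (r ∷ _) = inj₂ (inj₁ (here (All.zipWith (λ (1≢ , l) → notOne⇒big 1≢ l) (r , ls))))
findOne (neg {zero} _ ∷ ls) (r ∷ _) = inj₂ (inj₂ (here (All.zipWith (λ (1≢ , l) → notOne⇒big 1≢ l) (r , ls))))
findOne (pos {suc i} (s≤s i<m) ∷ ls) (_ ∷ rs) with findOne ls rs
... | inj₁ bs        = inj₁ (pos i<m ∷ bs)
... | inj₂ (inj₁ o)  = inj₂ (inj₁ (there (pos i<m) o))
... | inj₂ (inj₂ o)  = inj₂ (inj₂ (there (pos i<m) o))
findOne (neg {suc i} (s≤s i<m) ∷ ls) (_ ∷ rs) with findOne ls rs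
... | inj₁ bs        = inj₁ (neg i<m ∷ bs)
... | inj₂ (inj₁ o)  = inj₂ (inj₁ (there (neg i<m) o))
... | inj₂ (inj₂ o)  = inj₂ (inj₂ (there (neg i<m) o))

-- Pigeonhole: if all letters were big, rotating would fit m+1 of them into [±m].
oneAt : ∀ {m w} → IsSigned (suc m) w → OneAt m (+ 1) w ⊎ OneAt m -[1+ 0 ] w
oneAt {m} {w} (isSigned len ls d) with findOne ls d
... | inj₂ o  = o
... | inj₁ bs = contradiction
  (subst (_≤ m) (trans (LP.length-map (rotate m) w) len) (length≤ (AllP.map⁺ (All.map rotated bs)) (distinct-rotate ls d)))
  (ℕP.<-irrefl refl)
  where
  rotated : ∀ {x} → Big m x → Letter m (rotate m x)
  rotated (pos j<m) = pos j<m
  rotated (neg j<m) = neg j<m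

-- Boolean comparisons and counts

⌊⌋-cong : ∀ {P Q : Set} (p? : Dec P) (q? : Dec Q) → does p? ≡ does q? → ⌊ p? ⌋ ≡ ⌊ q? ⌋
⌊⌋-cong p? q? eq = trans (isYes≗does p?) (trans eq (sym (isYes≗does q?)))

<?-suc : ∀ a b → ⌊ suc a ℕ.<? suc b ⌋ ≡ ⌊ a ℕ.<? b ⌋
<?-suc a b = ⌊⌋-cong (suc a ℕ.<? suc b) (a ℕ.<? b) refl

<?-true : ∀ {a b} → a < b → ⌊ a ℕ.<? b ⌋ ≡ true
<?-true {a} {b} a<b = trans (isYes≗does (a ℕ.<? b)) (dec-true (a ℕ.<? b) a<b)

<?-false : ∀ {a b} → b ≤ a → ⌊ a ℕ.<? b ⌋ ≡ false
<?-false {a} {b} b≤a = trans (isYes≗does (a ℕ.<? b)) (dec-false (a ℕ.<? b) (ℕP.≤⇒≯ b≤a))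

module _ {A B : Set} {f : A → B} {p : B → Bool} {q : A → Bool} where

  countB-map : ∀ {w} → All (λ y → p (f y) ≡ q y) w → countB p (map f w) ≡ countB q w
  countB-map []                 = refl
  countB-map {y ∷ _} (eq ∷ eqs) rewrite eq | countB-map eqs = refl

countB-∷-suc : ∀ {A B : Set} (p : A → Bool) (q : B → Bool) x y v w →
               p x ≡ q y → countB p v ≡ suc (countB q w) → countB p (x ∷ v) ≡ suc (countB q (y ∷ w))
countB-∷-suc p q x y v w eq eqs rewrite eq with q y
... | true  = cong suc eqs
... | false = eqs

module _ {A : Set} {p : A → Bool} where

  countB-true : ∀ {w} → All (λ y → p y ≡ true) w → countB p w ≡ length w
  countB-true []         = refl
  countB-true (eq ∷ eqs) rewrite eq = cong suc (countB-true eqs)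

  countB-false : ∀ {w} → All (λ y → p y ≡ false) w → countB p w ≡ 0
  countB-false []         = refl
  countB-false (eq ∷ eqs) rewrite eq = countB-false eqs

  countB-∷⁺ : ∀ {x} w → p x ≡ true → countB p (x ∷ w) ≡ suc (countB p w)
  countB-∷⁺ w eq rewrite eq = refl

  countB-∷⁻ : ∀ {x} w → p x ≡ false → countB p (x ∷ w) ≡ countB p w
  countB-∷⁻ w eq rewrite eq = refl

  countB-∷ʳ : ∀ w {x} → p x ≡ false → countB p (w ∷ʳ x) ≡ countB p w
  countB-∷ʳ []      eq rewrite eq = refl
  countB-∷ʳ (y ∷ w) eq with p y
  ... | true  = cong suc (countB-∷ʳ w eq)
  ... | false = countB-∷ʳ w eq

∣>∣ : ℤ → ℤ → Bool
∣>∣ a b = ⌊ ∣ b ∣ ℕ.<? ∣ a ∣ ⌋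

inv∣∣ : List ℤ → ℕ
inv∣∣ = pairCount ∣>∣

module _ {m : ℕ} where

  private
    ρ = rotate m

  ∣>∣-rotate : ∀ {x y} → Big m x → Big m y → ∣>∣ (ρ x) (ρ y) ≡ ∣>∣ x y
  ∣>∣-rotate (pos {i} _) (pos {j} _) = sym (<?-suc (suc j) (suc i))
  ∣>∣-rotate (pos {i} _) (neg {j} _) = sym (<?-suc (suc j) (suc i))
  ∣>∣-rotate (neg {i} _) (pos {j} _) = sym (<?-suc (suc j) (suc i))
  ∣>∣-rotate (neg {i} _) (neg {j} _) = sym (<?-suc (suc j) (suc i))

  succOrd-rotate : ∀ {x y} → Big m x → Big m y → succOrd (ρ x) (ρ y) ≡ succOrd x y
  succOrd-rotate (pos {i} _) (pos {j} _) = ⌊⌋-cong (+ suc j ℤ.<? + suc i) (+ suc (suc j) ℤ.<? + suc (suc i)) refl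
  succOrd-rotate (pos _) (neg _) = refl
  succOrd-rotate (neg _) (pos _) = refl
  succOrd-rotate (neg {i} _) (neg {j} _) = sym (<?-suc (suc j) (suc i))

  isNeg-rotate : ∀ {x} → Big m x → isNeg (ρ x) ≡ isNeg x
  isNeg-rotate (pos _) = refl
  isNeg-rotate (neg _) = refl

  inv∣∣-big : ∀ {w} → All (Big m) w → inv∣∣ (map ρ w) ≡ inv∣∣ w
  inv∣∣-big []       = refl
  inv∣∣-big (b ∷ bs) = cong₂ ℕ._+_ (countB-map (All.map (∣>∣-rotate b) bs)) (inv∣∣-big bs)

  module _ {x : ℤ} (∣x∣≡1 : ∣ x ∣ ≡ 1) where

    ∣ρone∣ : ∣ ρ x ∣ ≡ suc m
    ∣ρone∣ = trans (∣rotate∣ m x) (cong (rotate∣∣ m) ∣x∣≡1)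

    big>one : ∀ {y} → Big m y → ∣>∣ y x ≡ true
    big>one (pos _) rewrite ∣x∣≡1 = refl
    big>one (neg _) rewrite ∣x∣≡1 = refl

    one≯big : ∀ {y} → Big m y → ∣>∣ x y ≡ false
    one≯big (pos _) rewrite ∣x∣≡1 = refl
    one≯big (neg _) rewrite ∣x∣≡1 = refl

    ρbig≯ρone : ∀ {y} → Big m y → ∣>∣ (ρ y) (ρ x) ≡ false
    ρbig≯ρone (pos j<m) rewrite ∣ρone∣ = <?-false (s≤s (ℕP.<⇒≤ j<m))
    ρbig≯ρone (neg j<m) rewrite ∣ρone∣ = <?-false (s≤s (ℕP.<⇒≤ j<m))

    ρone>ρbig : ∀ {y} → Big m y → ∣>∣ (ρ x) (ρ y) ≡ true
    ρone>ρbig (pos j<m) rewrite ∣ρone∣ = <?-true (s≤s j<m)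
    ρone>ρbig (neg j<m) rewrite ∣ρone∣ = <?-true (s≤s j<m)

  -- An entry to the left of the letter of absolute value 1 forms an inversion with it, and loses
  -- just this one when that letter acquires the greatest absolute value.
  count-one : ∀ {x y w} → ∣ x ∣ ≡ 1 → Big m y → OneAt m x w →
              countB (∣>∣ y) w ≡ suc (countB (∣>∣ (ρ y)) (map ρ w))
  count-one {x} {y} {_ ∷ w} ∣x∣≡1 b (here bs) = begin
    countB (∣>∣ y) (x ∷ w)                        ≡⟨ countB-∷⁺ {x = x} w (big>one {x} ∣x∣≡1 b) ⟩
    suc (countB (∣>∣ y) w)                        ≡⟨ cong suc (countB-map (All.map (∣>∣-rotate b) bs)) ⟨
    suc (countB (∣>∣ (ρ y)) (map ρ w))            ≡⟨ cong suc (countB-∷⁻ {x = ρ x} (map ρ w) (ρbig≯ρone {x} ∣x∣≡1 b)) ⟨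
    suc (countB (∣>∣ (ρ y)) (ρ x ∷ map ρ w))      ∎
    where open ≡-Reasoning
  count-one {y = y} ∣x∣≡1 b (there {z} {w} c o) =
    countB-∷-suc (∣>∣ y) (∣>∣ (ρ y)) z (ρ z) w (map ρ w) (sym (∣>∣-rotate b c)) (count-one ∣x∣≡1 b o)

  -- Entries left of the letter of absolute value 1 lose one inversion each, entries right of it
  -- gain one, so the parity changes by `length w` minus one. The outer negation stands for the
  -- minus one.
  sgn-inv∣∣-rotate : ∀ {x w} → ∣ x ∣ ≡ 1 → OneAt m x w →
                     sgn (inv∣∣ (map ρ w)) ≡ ℤ.- (sgn (length w) ℤ.* sgn (inv∣∣ w))
  sgn-inv∣∣-rotate {x} {_ ∷ w} ∣x∣≡1 (here bs) = begin
    sgn (countB (∣>∣ (ρ x)) (map ρ w) ℕ.+ inv∣∣ (map ρ w))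
      ≡⟨ cong₂ (λ a b → sgn (a ℕ.+ b))
           (trans (countB-true {p = ∣>∣ (ρ x)} (AllP.map⁺ (All.map (ρone>ρbig {x} ∣x∣≡1) bs))) (LP.length-map ρ w)) (inv∣∣-big bs) ⟩
    sgn (length w ℕ.+ inv∣∣ w)
      ≡⟨ sgn-+ (length w) (inv∣∣ w) ⟩
    sgn (length w) ℤ.* sgn (inv∣∣ w)
      ≡⟨ ℤP.neg-involutive _ ⟨
    ℤ.- ℤ.- (sgn (length w) ℤ.* sgn (inv∣∣ w))
      ≡⟨ cong ℤ.-_ (ℤP.neg-distribˡ-* (sgn (length w)) _) ⟩
    ℤ.- (ℤ.- sgn (length w) ℤ.* sgn (inv∣∣ w))
      ≡⟨ cong (λ c → ℤ.- (ℤ.- sgn (length w) ℤ.* sgn (c ℕ.+ inv∣∣ w))) (countB-false {p = ∣>∣ x} (All.map (one≯big {x} ∣x∣≡1) bs)) ⟨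
    ℤ.- (ℤ.- sgn (length w) ℤ.* sgn (countB (∣>∣ x) w ℕ.+ inv∣∣ w)) ∎
    where
    open ≡-Reasoning
  sgn-inv∣∣-rotate {x} {y ∷ w} ∣x∣≡1 (there b o) = begin
    sgn (c ℕ.+ inv∣∣ (map ρ w))
      ≡⟨ sgn-+ c _ ⟩
    sgn c ℤ.* sgn (inv∣∣ (map ρ w))
      -- The entry `y` adds one to the length and one lost inversion; the two signs cancel.
      ≡⟨ cong (sgn c ℤ.*_) (sgn-inv∣∣-rotate ∣x∣≡1 o) ⟩
    sgn c ℤ.* ℤ.- (sgn (length w) ℤ.* sgn (inv∣∣ w))
      ≡⟨ signs (sgn c) (sgn (length w)) (sgn (inv∣∣ w)) ⟩
    ℤ.- (ℤ.- sgn (length w) ℤ.* (ℤ.- sgn c ℤ.* sgn (inv∣∣ w)))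
      ≡⟨ cong (λ s → ℤ.- (ℤ.- sgn (length w) ℤ.* s)) (sgn-+ (suc c) (inv∣∣ w)) ⟨
    ℤ.- (ℤ.- sgn (length w) ℤ.* sgn (suc c ℕ.+ inv∣∣ w))
      ≡⟨ cong (λ d → ℤ.- (ℤ.- sgn (length w) ℤ.* sgn (d ℕ.+ inv∣∣ w))) (count-one ∣x∣≡1 b o) ⟨
    ℤ.- (ℤ.- sgn (length w) ℤ.* sgn (countB (∣>∣ y) w ℕ.+ inv∣∣ w)) ∎
    where
    open ≡-Reasoning
    c = countB (∣>∣ (ρ y)) (map ρ w)
    signs : ∀ a b d → a ℤ.* ℤ.- (b ℤ.* d) ≡ ℤ.- (ℤ.- b ℤ.* (ℤ.- a ℤ.* d))
    signs = ℤSolver.solve-∀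

  N₁-one⁺ : ∀ {w} → OneAt m (+ 1) w → N₁ (map ρ w) ≡ suc (N₁ w)
  N₁-one⁺ (here bs) = cong suc (countB-map (All.map isNeg-rotate bs))
  N₁-one⁺ (there {y} {w} b o) = countB-∷-suc isNeg isNeg (ρ y) y (map ρ w) w (isNeg-rotate b) (N₁-one⁺ o)

  N₁-one⁻ : ∀ {w} → OneAt m -[1+ 0 ] w → N₁ w ≡ suc (N₁ (map ρ w))
  N₁-one⁻ (here bs) = cong suc (sym (countB-map (All.map isNeg-rotate bs)))
  N₁-one⁻ (there {y} {w} b o) = countB-∷-suc isNeg isNeg y (ρ y) w (map ρ w) (sym (isNeg-rotate b)) (N₁-one⁻ o)

  -- In ≺ the letter 1 separates the big negatives from the big positives, and so does its image
  -- -(m+1) among the images. Hence `maj` does not notice this wrap.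
  succOrd-1ˡ : ∀ {y} → Big m y → succOrd (ρ (+ 1)) (ρ y) ≡ succOrd (+ 1) y
  succOrd-1ˡ (pos _)   = refl
  succOrd-1ˡ (neg j<m) = <?-true (s≤s j<m)

  succOrd-1ʳ : ∀ {y} → Big m y → succOrd (ρ y) (ρ (+ 1)) ≡ succOrd y (+ 1)
  succOrd-1ʳ (pos _)   = refl
  succOrd-1ʳ (neg j<m) = <?-false (s≤s (ℕP.<⇒≤ j<m))

  succOrd-minˡ : ∀ {y} → Big m y → succOrd -[1+ 0 ] y ≡ false
  succOrd-minˡ (pos _) = refl
  succOrd-minˡ (neg _) = refl

  succOrd-minʳ : ∀ {y} → Big m y → succOrd y -[1+ 0 ] ≡ true
  succOrd-minʳ (pos _) = refl
  succOrd-minʳ (neg _) = refl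

  succOrd-maxˡ : ∀ {y} → Big m y → succOrd (+ suc m) (ρ y) ≡ true
  succOrd-maxˡ (pos {j} j<m) = trans (⌊⌋-cong (+ suc j ℤ.<? + suc m) (j ℕ.<? m) refl) (<?-true j<m)
  succOrd-maxˡ (neg _)       = refl

  succOrd-maxʳ : ∀ {y} → Big m y → succOrd (ρ y) (+ suc m) ≡ false
  succOrd-maxʳ (pos {j} j<m) = trans (⌊⌋-cong (+ suc m ℤ.<? + suc j) (m ℕ.<? j) refl) (<?-false (ℕP.<⇒≤ j<m))
  succOrd-maxʳ (neg _)       = refl

  descent : ℕ → Bool → ℕ → ℕ
  descent i b k = (if b then i else 0) ℕ.+ k

  majFrom-big : ∀ i {w} → All (Big m) w → majFrom i (map ρ w) ≡ majFrom i w
  majFrom-big i []           = refl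
  majFrom-big i (b ∷ [])     = refl
  majFrom-big i (b ∷ c ∷ bs) = cong₂ (descent i) (succOrd-rotate b c) (majFrom-big (suc i) (c ∷ bs))

  majFrom-one⁺ : ∀ i {w} → OneAt m (+ 1) w → majFrom i (map ρ w) ≡ majFrom i w
  majFrom-one⁺ i (here [])             = refl
  majFrom-one⁺ i (here (b ∷ bs))       = cong₂ (descent i) (succOrd-1ˡ b) (majFrom-big (suc i) (b ∷ bs))
  majFrom-one⁺ i (there b (here bs))   = cong₂ (descent i) (succOrd-1ʳ b) (majFrom-one⁺ (suc i) (here bs))
  majFrom-one⁺ i (there b (there c o)) = cong₂ (descent i) (succOrd-rotate b c) (majFrom-one⁺ (suc i) (there c o))

  -- Here the least letter becomes the greatest, so a descent moves from its left to its right.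
  majFrom-head⁻ : ∀ i {w} → All (Big m) w → last (-[1+ 0 ] ∷ w) ≢ just -[1+ 0 ] →
                  majFrom i (map ρ (-[1+ 0 ] ∷ w)) ≡ i ℕ.+ majFrom i (-[1+ 0 ] ∷ w)
  majFrom-head⁻ i []       ≢last = contradiction refl ≢last
  majFrom-head⁻ i {w} (b ∷ bs) _ = trans
    (cong₂ (descent i) (succOrd-maxˡ b) (majFrom-big (suc i) (b ∷ bs)))
    (cong (λ d → i ℕ.+ descent i d (majFrom (suc i) w)) (sym (succOrd-minˡ b)))

  -- The descent from the preceding entry into -1, at position p, is replaced by the descent out of
  -- m+1 at position p+1.
  majFrom-one⁻ : ∀ i {y w} → Big m y → OneAt m -[1+ 0 ] w → last w ≢ just -[1+ 0 ] →
                 majFrom i (map ρ (y ∷ w)) ≡ suc (majFrom i (y ∷ w))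
  majFrom-one⁻ i b (here bs) ≢last = trans
    (cong₂ (descent i) (succOrd-maxʳ b) (majFrom-head⁻ (suc i) bs ≢last))
    (cong (λ d → suc (descent i d _)) (sym (succOrd-minʳ b)))
  majFrom-one⁻ i b (there c o) ≢last = trans
    (cong₂ (descent i) (succOrd-rotate b c) (majFrom-one⁻ (suc i) c o (≢last ∘ last-there o)))
    (ℕP.+-suc _ _)
    where
    last-there : ∀ {x y w l} → OneAt m x w → last w ≡ l → last (y ∷ w) ≡ l
    last-there (here _)    eq = eq
    last-there (there _ _) eq = eq

  -- If -1 comes first there is no descent to lose, but the descent gained is at position 1, so the
  -- increase is again one.
  maj-one⁻ : ∀ {w} → OneAt m -[1+ 0 ] w → last w ≢ just -[1+ 0 ] → maj (map ρ w) ≡ suc (maj w)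
  maj-one⁻ (here bs) ≢last = majFrom-head⁻ 1 bs ≢last
  maj-one⁻ (there b (here bs)) ≢last = majFrom-one⁻ 1 b (here bs) ≢last
  maj-one⁻ (there b (there c o)) ≢last = majFrom-one⁻ 1 b (there c o) ≢last

  sgn-inv∣∣-step : ∀ {w} → IsSigned (suc m) w → sgn (inv∣∣ (map ρ w)) ≡ sgn m ℤ.* sgn (inv∣∣ w)
  sgn-inv∣∣-step {w} s = begin
    sgn (inv∣∣ (map ρ w))                        ≡⟨ step (oneAt s) ⟩
    ℤ.- (sgn (length w) ℤ.* sgn (inv∣∣ w))       ≡⟨ cong (λ l → ℤ.- (sgn l ℤ.* sgn (inv∣∣ w))) (length≡ s) ⟩
    ℤ.- (ℤ.- sgn m ℤ.* sgn (inv∣∣ w))            ≡⟨ cong ℤ.-_ (ℤP.neg-distribˡ-* (sgn m) _) ⟨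
    ℤ.- ℤ.- (sgn m ℤ.* sgn (inv∣∣ w))            ≡⟨ ℤP.neg-involutive _ ⟩
    sgn m ℤ.* sgn (inv∣∣ w)                      ∎
    where
    open ≡-Reasoning
    step : _ → _
    step (inj₁ o) = sgn-inv∣∣-rotate refl o
    step (inj₂ o) = sgn-inv∣∣-rotate refl o

  -- If 1 occurs, `maj` is fixed and `N₁` grows by one; if -1 occurs, 2 `maj` grows by two and `N₁`
  -- drops by one.
  fmaj-step : ∀ {w} → IsSigned (suc m) w → last w ≢ just -[1+ 0 ] → fmaj (map ρ w) ≡ suc (fmaj w)
  fmaj-step {w} s ≢last with oneAt s
  ... | inj₁ o = trans (cong₂ (λ a b → 2 ℕ.* a ℕ.+ b) (majFrom-one⁺ 1 o) (N₁-one⁺ o)) (ℕP.+-suc (2 ℕ.* maj w) (N₁ w))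
  ... | inj₂ o = begin
    2 ℕ.* maj (map ρ w) ℕ.+ N₁ (map ρ w)      ≡⟨ cong (λ a → 2 ℕ.* a ℕ.+ N₁ (map ρ w)) (maj-one⁻ o ≢last) ⟩
    2 ℕ.* suc (maj w) ℕ.+ N₁ (map ρ w)        ≡⟨ lem (maj w) (N₁ (map ρ w)) ⟩
    suc (2 ℕ.* maj w ℕ.+ suc (N₁ (map ρ w)))  ≡⟨ cong (λ b → suc (2 ℕ.* maj w ℕ.+ b)) (N₁-one⁻ o) ⟨
    suc (fmaj w)                              ∎
    where
    open ≡-Reasoning
    lem : ∀ a b → 2 ℕ.* suc a ℕ.+ b ≡ suc (2 ℕ.* a ℕ.+ suc b)
    lem = solve-∀

-- Appending the greatest letter

inv∣∣-∷ʳ : ∀ {m w} → All (Letter m) w → inv∣∣ (w ∷ʳ + suc m) ≡ inv∣∣ w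
inv∣∣-∷ʳ []       = refl
inv∣∣-∷ʳ {m} {x ∷ w} (l ∷ ls) = cong₂ ℕ._+_ (countB-∷ʳ w (≯ l)) (inv∣∣-∷ʳ ls)
  where
  ≯ : ∀ {x} → Letter m x → ∣>∣ x (+ suc m) ≡ false
  ≯ (pos i<m) = <?-false (ℕP.m≤n⇒m≤1+n i<m)
  ≯ (neg i<m) = <?-false (ℕP.m≤n⇒m≤1+n i<m)

majFrom-∷ʳ : ∀ {m} i {w} → All (Letter m) w → majFrom i (w ∷ʳ + suc m) ≡ majFrom i w
majFrom-∷ʳ i []           = refl
majFrom-∷ʳ {m} i (pos {j} j<m ∷ []) = cong (λ d → (if d then i else 0) ℕ.+ 0)
  (trans (⌊⌋-cong (+ suc m ℤ.<? + suc j) (m ℕ.<? j) refl) (<?-false (ℕP.<⇒≤ j<m)))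
majFrom-∷ʳ i (neg _ ∷ [])   = refl
majFrom-∷ʳ i (l ∷ l′ ∷ ls) = cong (_ ℕ.+_) (majFrom-∷ʳ (suc i) (l′ ∷ ls))

fmaj-∷ʳ : ∀ {m w} → All (Letter m) w → fmaj (w ∷ʳ + suc m) ≡ fmaj w
fmaj-∷ʳ {m} {w} ls = cong₂ (λ a b → 2 ℕ.* a ℕ.+ b) (majFrom-∷ʳ 1 ls) (countB-∷ʳ w refl)

-- The type D length modulo 2

sgnB : Bool → ℤ
sgnB true  = ℤ.- + 1
sgnB false = + 1

sgn-countB : ∀ {A : Set} (p : A → Bool) y w → sgn (countB p (y ∷ w)) ≡ sgnB (p y) ℤ.* sgn (countB p w)
sgn-countB p y w with p y
... | true  = sym (ℤP.-1*i≡-i _)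
... | false = sym (ℤP.*-identityˡ _)

isNeg-⊖-true : ∀ {i j} → i < j → isNeg (i ℤ.⊖ j) ≡ true
isNeg-⊖-true {i} {j} i<j rewrite ℤP.⊖-< i<j with j ℕ.∸ i | ℕP.m<n⇒0<n∸m i<j
... | suc _ | _ = refl

isNeg-⊖-false : ∀ {i j} → j ≤ i → isNeg (i ℤ.⊖ j) ≡ false
isNeg-⊖-false {i} {j} j≤i rewrite ℤP.⊖-≥ j≤i = refl

<?-neg : ∀ i j → ⌊ -[1+ j ] ℤ.<? -[1+ i ] ⌋ ≡ ⌊ i ℕ.<? j ⌋
<?-neg i j = ⌊⌋-cong (-[1+ j ] ℤ.<? -[1+ i ]) (i ℕ.<? j) refl

-- If both letters are positive, the sum is positive and the usual order is that of absolute values.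
-- If both are negative, the order is reversed and the negative sum corrects it. For opposite signs,
-- b < a depends only on the signs, and the sum has the sign of the letter larger in absolute value.
pair-sign : ∀ {n a b} → Letter n a → Letter n b → ∣ a ∣ ≢ ∣ b ∣ →
            sgnB ⌊ b ℤ.<? a ⌋ ℤ.* sgnB (isNeg (a ℤ.+ b)) ≡ sgnB (∣>∣ a b)
pair-sign (pos {i} _) (pos {j} _) _ = trans (ℤP.*-identityʳ _) (cong sgnB (⌊⌋-cong (+ suc j ℤ.<? + suc i) (suc j ℕ.<? suc i) refl))
pair-sign (pos {i} _) (neg {j} _) a≢b with ℕP.<-cmp i j
-- Both Booleans are replaced by their values, which leaves a closed equation between integers.
... | tri< i<j _ _ = subst id (sym (cong₂ (λ b c → ℤ.- + 1 ℤ.* sgnB b ≡ sgnB c)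
  (isNeg-⊖-true (s≤s i<j)) (<?-false (s≤s (ℕP.<⇒≤ i<j))))) refl
... | tri≈ _ refl _ = contradiction refl a≢b
... | tri> _ _ j<i = subst id (sym (cong₂ (λ b c → ℤ.- + 1 ℤ.* sgnB b ≡ sgnB c)
  (isNeg-⊖-false (s≤s (ℕP.<⇒≤ j<i))) (<?-true (s≤s j<i)))) refl
pair-sign (neg {i} _) (pos {j} _) a≢b with ℕP.<-cmp i j
... | tri< i<j _ _ = subst id (sym (cong₂ (λ b c → + 1 ℤ.* sgnB b ≡ sgnB c)
  (isNeg-⊖-false (s≤s (ℕP.<⇒≤ i<j))) (<?-false (s≤s (ℕP.<⇒≤ i<j))))) refl
... | tri≈ _ refl _ = contradiction refl a≢b
... | tri> _ _ j<i = subst id (sym (cong₂ (λ b c → + 1 ℤ.* sgnB b ≡ sgnB c)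
  (isNeg-⊖-true (s≤s j<i)) (<?-true (s≤s j<i)))) refl
pair-sign (neg {i} _) (neg {j} _) a≢b with ℕP.<-cmp i j
... | tri< i<j _ _ = subst id (sym (cong₂ (λ b c → sgnB b ℤ.* ℤ.- + 1 ≡ sgnB c)
  (trans (<?-neg i j) (<?-true i<j)) (<?-false (s≤s (ℕP.<⇒≤ i<j))))) refl
... | tri≈ _ refl _ = contradiction refl a≢b
... | tri> _ _ j<i = subst id (sym (cong₂ (λ b c → sgnB b ℤ.* ℤ.- + 1 ≡ sgnB c)
  (trans (<?-neg i j) (<?-false (ℕP.<⇒≤ j<i))) (<?-true (s≤s j<i)))) refl

sgn-ℓD : ∀ {n w} → All (Letter n) w → DistinctAbs w → sgn (ℓD w) ≡ sgn (inv∣∣ w)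
sgn-ℓD [] [] = refl
sgn-ℓD {n} {x ∷ w} (l ∷ ls) (r ∷ rs) = begin
  sgn ((a ℕ.+ inv w) ℕ.+ (b ℕ.+ N₂ w))               ≡⟨ cong sgn (swap-middle a (inv w) b (N₂ w)) ⟩
  sgn ((a ℕ.+ b) ℕ.+ ℓD w)                           ≡⟨ sgn-+ (a ℕ.+ b) (ℓD w) ⟩
  sgn (a ℕ.+ b) ℤ.* sgn (ℓD w)                       ≡⟨ cong₂ ℤ._*_ (trans (sgn-+ a b) (row ls r)) (sgn-ℓD ls rs) ⟩
  sgn (countB (∣>∣ x) w) ℤ.* sgn (inv∣∣ w)           ≡⟨ sgn-+ (countB (∣>∣ x) w) (inv∣∣ w) ⟨
  sgn (countB (∣>∣ x) w ℕ.+ inv∣∣ w)                 ∎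
  where
  open ≡-Reasoning
  swap-middle : ∀ a b c d → (a ℕ.+ b) ℕ.+ (c ℕ.+ d) ≡ (a ℕ.+ c) ℕ.+ (b ℕ.+ d)
  swap-middle = solve-∀
  p = λ y → ⌊ y ℤ.<? x ⌋
  q = λ y → isNeg (x ℤ.+ y)
  a = countB p w
  b = countB q w
  row : ∀ {v} → All (Letter n) v → All (λ y → ∣ x ∣ ≢ ∣ y ∣) v →
        sgn (countB p v) ℤ.* sgn (countB q v) ≡ sgn (countB (∣>∣ x) v)
  row [] [] = refl
  row {y ∷ v} (l′ ∷ ls) (r ∷ rs) = begin
    sgn (countB p (y ∷ v)) ℤ.* sgn (countB q (y ∷ v))
      ≡⟨ cong₂ ℤ._*_ (sgn-countB p y v) (sgn-countB q y v) ⟩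
    (sgnB (p y) ℤ.* sgn (countB p v)) ℤ.* (sgnB (q y) ℤ.* sgn (countB q v))
      ≡⟨ *-interchange (sgnB (p y)) _ (sgnB (q y)) _ ⟩
    (sgnB (p y) ℤ.* sgnB (q y)) ℤ.* (sgn (countB p v) ℤ.* sgn (countB q v))
      ≡⟨ cong₂ ℤ._*_ (pair-sign l l′ r) (row ls rs) ⟩
    sgnB (∣>∣ x y) ℤ.* sgn (countB (∣>∣ x) v)
      ≡⟨ sgn-countB (∣>∣ x) y v ⟨
    sgn (countB (∣>∣ x) (y ∷ v)) ∎

inv∣∣-cong : ∀ {v w} → map ∣_∣ v ≡ map ∣_∣ w → inv∣∣ v ≡ inv∣∣ w
inv∣∣-cong {[]}    {[]}    eq = refl
inv∣∣-cong {x ∷ v} {y ∷ w} eq = cong₂ ℕ._+_ (begin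
  countB (∣>∣ x) v                             ≡⟨ countB-map (All.universal (λ _ → refl) v) ⟨
  countB (λ a → ⌊ a ℕ.<? ∣ x ∣ ⌋) (map ∣_∣ v)  ≡⟨ cong₂ (λ b l → countB (λ a → ⌊ a ℕ.<? b ⌋) l) (LP.∷-injectiveˡ eq) (LP.∷-injectiveʳ eq) ⟩
  countB (λ a → ⌊ a ℕ.<? ∣ y ∣ ⌋) (map ∣_∣ w)  ≡⟨ countB-map (All.universal (λ _ → refl) w) ⟩
  countB (∣>∣ y) w                             ∎) (inv∣∣-cong (LP.∷-injectiveʳ eq))
  where open ≡-Reasoning

-- Membership in B_n and D_n

bfilter≡filter : ∀ {A : Set} (p : A → Bool) xs → bfilter p xs ≡ filter (λ x → p x Bool.≟ true) xs
bfilter≡filter p []       = refl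
bfilter≡filter p (x ∷ xs) with p x
... | true  = cong (x ∷_) (bfilter≡filter p xs)
... | false = bfilter≡filter p xs

module _ {A : Set} (p : A → Bool) {xs : List A} where

  ∈-bfilter⁺ : ∀ {x} → x ∈ xs → p x ≡ true → x ∈ bfilter p xs
  ∈-bfilter⁺ x∈ px rewrite bfilter≡filter p xs = ∈-filter⁺ (λ x → p x Bool.≟ true) x∈ px

  ∈-bfilter⁻ : ∀ {x} → x ∈ bfilter p xs → x ∈ xs × p x ≡ true
  ∈-bfilter⁻ x∈ rewrite bfilter≡filter p xs = ∈-filter⁻ (λ x → p x Bool.≟ true) x∈

  bfilter-unique : Unique xs → Unique (bfilter p xs)
  bfilter-unique u rewrite bfilter≡filter p xs = UniqueP.filter⁺ (λ x → p x Bool.≟ true) u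

module _ {A : Set} (alph : List A) where

  words-suc : ∀ k → words alph (suc k) ≡ cartesianProductWith _∷_ alph (words alph k)
  words-suc k = go alph
    where
    -- The first letter ranges over a separate list `xs`, while the alphabet inside `words alph k`
    -- stays fixed during the induction.
    go : ∀ xs → concatMap (λ a → map (a ∷_) (words alph k)) xs ≡ cartesianProductWith _∷_ xs (words alph k)
    go []       = refl
    go (x ∷ xs) = cong (map (x ∷_) (words alph k) ++_) (go xs)

  ∈-words⁺ : ∀ {w} → All (_∈ alph) w → w ∈ words alph (length w)
  ∈-words⁺ []                     = here refl
  ∈-words⁺ {_ ∷ w} (x∈ ∷ xs∈) rewrite words-suc (length w) = ∈-cartesianProductWith⁺ _∷_ x∈ (∈-words⁺ xs∈)

  ∈-words⁻ : ∀ k {w} → w ∈ words alph k → length w ≡ k × All (_∈ alph) w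
  ∈-words⁻ zero    (here refl) = refl , []
  ∈-words⁻ (suc k) w∈ rewrite words-suc k
    with _ , _ , x∈ , v∈ , refl ← ∈-cartesianProductWith⁻ _∷_ alph (words alph k) w∈
    with len , all∈ ← ∈-words⁻ k v∈ = cong suc len , x∈ ∷ all∈

  words-unique : Unique alph → ∀ k → Unique (words alph k)
  words-unique u zero    = [] ∷ []
  words-unique u (suc k) rewrite words-suc k =
    UniqueP.cartesianProductWith⁺ _∷_ LP.∷-injective u (words-unique u k)

∈-alphabet⁺ : ∀ {n x} → Letter n x → x ∈ alphabet n
∈-alphabet⁺     (pos i<n) = ∈-++⁺ˡ (∈-map⁺ (λ i → + suc i) (∈-upTo⁺ i<n))
∈-alphabet⁺ {n} (neg i<n) = ∈-++⁺ʳ (map (λ i → + suc i) (upTo n)) (∈-map⁺ -[1+_] (∈-upTo⁺ i<n))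

∈-alphabet⁻ : ∀ {n x} → x ∈ alphabet n → Letter n x
∈-alphabet⁻ {n} x∈ with ∈-++⁻ (map (λ i → + suc i) (upTo n)) x∈
... | inj₁ x∈⁺ with _ , i∈ , refl ← ∈-map⁻ (λ i → + suc i) x∈⁺ = pos (∈-upTo⁻ i∈)
... | inj₂ x∈⁻ with _ , i∈ , refl ← ∈-map⁻ -[1+_] x∈⁻          = neg (∈-upTo⁻ i∈)

alphabet-unique : ∀ n → Unique (alphabet n)
alphabet-unique n = UniqueP.++⁺
  (UniqueP.map⁺ (λ { refl → refl }) (UniqueP.upTo⁺ n))
  (UniqueP.map⁺ (λ { refl → refl }) (UniqueP.upTo⁺ n))
  λ (x∈⁺ , x∈⁻) → disjoint (∈-map⁻ _ x∈⁺) (∈-map⁻ _ x∈⁻)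
  where
  disjoint : ∀ {x} → (∃ λ i → i ∈ upTo n × x ≡ + suc i) → (∃ λ i → i ∈ upTo n × x ≡ -[1+ i ]) → _
  disjoint (_ , _ , refl) (_ , _ , ())

module _ {A : Set} {p : A → Bool} where

  anyB-false⁺ : ∀ {w} → All (λ y → p y ≡ false) w → anyB p w ≡ false
  anyB-false⁺ []         = refl
  anyB-false⁺ (eq ∷ eqs) rewrite eq = anyB-false⁺ eqs

  anyB-false⁻ : ∀ w → anyB p w ≡ false → All (λ y → p y ≡ false) w
  anyB-false⁻ []      _  = []
  anyB-false⁻ (y ∷ w) eq with p y in eq′
  ... | false = eq′ ∷ anyB-false⁻ w eq

≟-false⁺ : ∀ {a b} → a ≢ b → ⌊ a ℕ.≟ b ⌋ ≡ false
≟-false⁺ {a} {b} a≢b = trans (isYes≗does (a ℕ.≟ b)) (dec-false (a ℕ.≟ b) a≢b)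

≟-false⁻ : ∀ {a b} → ⌊ a ℕ.≟ b ⌋ ≡ false → a ≢ b
≟-false⁻ {a} {b} eq a≡b with () ← trans (sym eq) (trans (isYes≗does (a ℕ.≟ b)) (dec-true (a ℕ.≟ b) a≡b))

distinctAbs⁺ : ∀ {w} → DistinctAbs w → distinctAbs w ≡ true
distinctAbs⁺ []       = refl
distinctAbs⁺ (r ∷ rs) = cong₂ (λ a b → not a ∧ b) (anyB-false⁺ (All.map ≟-false⁺ r)) (distinctAbs⁺ rs)

distinctAbs⁻ : ∀ w → distinctAbs w ≡ true → DistinctAbs w
distinctAbs⁻ []      _  = []
distinctAbs⁻ (x ∷ w) eq with anyB (λ y → ⌊ ∣ x ∣ ℕ.≟ ∣ y ∣ ⌋) w in eq′
... | false = All.map ≟-false⁻ (anyB-false⁻ w eq′) ∷ distinctAbs⁻ w eq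

∈-Bn⁺ : ∀ {n w} → IsSigned n w → w ∈ Bn n
∈-Bn⁺ {n} (isSigned refl ls d) = ∈-bfilter⁺ distinctAbs (∈-words⁺ (alphabet n) (All.map ∈-alphabet⁺ ls)) (distinctAbs⁺ d)

∈-Bn⁻ : ∀ {n w} → w ∈ Bn n → IsSigned n w
∈-Bn⁻ {n} {w} w∈ =
  let w∈words , d = ∈-bfilter⁻ distinctAbs w∈
      len , ls    = ∈-words⁻ (alphabet n) n w∈words
  in isSigned len (All.map ∈-alphabet⁻ ls) (distinctAbs⁻ w d)

Bn-unique : ∀ n → Unique (Bn n)
Bn-unique n = bfilter-unique distinctAbs (words-unique (alphabet n) (alphabet-unique n) n)

-- The enumeration of B_{m+1} and D_{m+1} by rotations

-- Injectivity is asked on the list only: `build` is injective only within one full turn, and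
-- `absLast` only on words of equal parity of `N₁`.
unique-map : ∀ {A B : Set} (f : A → B) {xs} → (∀ {x y} → x ∈ xs → y ∈ xs → f x ≡ f y → x ≡ y) →
             Unique xs → Unique (map f xs)
unique-map f inj []       = []
unique-map f inj (r ∷ rs) =
  AllP.map⁺ (All.tabulate λ y∈ fx≡fy → All.lookup r y∈ (inj (here refl) (there y∈) fx≡fy))
  ∷ unique-map f (λ x∈ y∈ → inj (there x∈) (there y∈)) rs

↭-from-⇔ : ∀ {A : Set} {xs ys : List A} → Unique xs → Unique ys →
           (∀ {x} → x ∈ xs → x ∈ ys) → (∀ {x} → x ∈ ys → x ∈ xs) → xs ↭ ys
↭-from-⇔ u v to from = ∼bag⇒↭ (unique∧set⇒bag u v (mk⇔ to from))

last-∷ʳ : ∀ {A : Set} (w : List A) x → last (w ∷ʳ x) ≡ just x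
last-∷ʳ []          x = refl
last-∷ʳ (y ∷ [])    x = refl
last-∷ʳ (y ∷ z ∷ w) x = last-∷ʳ (z ∷ w) x

length-∷ʳ : ∀ {A : Set} (w : List A) {x} → length (w ∷ʳ x) ≡ suc (length w)
length-∷ʳ w = trans (LP.length-++ w) (ℕP.+-comm (length w) 1)

fold-∷ʳ : ∀ {A : Set} (f : A → A) k w x → fold (w ∷ʳ x) (map f) k ≡ fold w (map f) k ∷ʳ fold x f k
fold-∷ʳ f zero    w x = refl
fold-∷ʳ f (suc k) w x = trans (cong (map f) (fold-∷ʳ f k w x)) (LP.map-++ f (fold w (map f) k) (fold x f k ∷ []))

lastLetter : ∀ {n} w {x} → IsSigned n (w ∷ʳ x) → Letter n x
lastLetter w s = proj₂ (AllP.∷ʳ⁻ (letters s))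

-- Used to flip the sign of the last letter when passing between γ and |γ|_n.
changeLast : ∀ {n} w {x y} → ∣ x ∣ ≡ ∣ y ∣ → Letter n y → IsSigned n (w ∷ʳ x) → IsSigned n (w ∷ʳ y)
changeLast w {x} {y} ∣x∣≡∣y∣ l s =
  let d , r = AllPairs-∷ʳ⁻ w (distinct s) in isSigned
    (trans (trans (length-∷ʳ w) (sym (length-∷ʳ w))) (length≡ s))
    (AllP.∷ʳ⁺ (proj₁ (AllP.∷ʳ⁻ (letters s))) l)
    (AllPairs-∷ʳ⁺ d (All.map (λ ≢x eq → ≢x (trans eq (sym ∣x∣≡∣y∣))) r))

append-max : ∀ {m w} → IsSigned m w → IsSigned (suc m) (w ∷ʳ + suc m)
append-max {m} {w} (isSigned len ls d) = isSigned
  (trans (length-∷ʳ w) (cong suc len))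
  (AllP.∷ʳ⁺ (All.map weaken ls) (pos ℕP.≤-refl))
  (AllPairs-∷ʳ⁺ d (All.map small ls))
  where
  weaken : ∀ {x} → Letter m x → Letter (suc m) x
  weaken (pos i<m) = pos (ℕP.m≤n⇒m≤1+n i<m)
  weaken (neg i<m) = neg (ℕP.m≤n⇒m≤1+n i<m)
  small : ∀ {x} → Letter m x → ∣ x ∣ ≢ suc m
  small (pos i<m) refl = ℕP.<-irrefl refl i<m
  small (neg i<m) refl = ℕP.<-irrefl refl i<m

remove-max : ∀ {m w} → IsSigned (suc m) (w ∷ʳ + suc m) → IsSigned m w
remove-max {m} {w} (isSigned len ls d) = isSigned
  (ℕP.suc-injective (trans (sym (length-∷ʳ w)) len))
  (All.zipWith strengthen (proj₁ (AllP.∷ʳ⁻ ls) , proj₂ (AllPairs-∷ʳ⁻ w d)))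
  (proj₁ (AllPairs-∷ʳ⁻ w d))
  where
  strengthen : ∀ {x} → Letter (suc m) x × ∣ x ∣ ≢ suc m → Letter m x
  strengthen (pos i≤m , ≢max) = pos (ℕP.≤∧≢⇒< (ℕP.≤-pred i≤m) (≢max ∘ cong suc))
  strengthen (neg i≤m , ≢max) = neg (ℕP.≤∧≢⇒< (ℕP.≤-pred i≤m) (≢max ∘ cong suc))

module _ (m : ℕ) where

  private
    ρ = rotate m
    -- The rank 2m+1 of the greatest letter, and hence the largest number of rotations before the
    -- last letter wraps from -1 to m+1.
    top = suc m ℕ.+ m

  build : ℕ × List ℤ → List ℤ
  build (k , w) = fold (w ∷ʳ + suc m) (map ρ) k

  build-∷ʳ : ∀ k w → build (k , w) ≡ fold w (map ρ) k ∷ʳ fold (+ suc m) ρ k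
  build-∷ʳ k w = fold-∷ʳ ρ k w (+ suc m)

  build-signed : ∀ k {w} → IsSigned m w → IsSigned (suc m) (build (k , w))
  build-signed zero    s = append-max s
  build-signed (suc k) s = isSigned-rotate (build-signed k s)

  lastOf-letter : ∀ k → Letter (suc m) (fold (+ suc m) ρ k)
  lastOf-letter zero    = pos ℕP.≤-refl
  lastOf-letter (suc k) = Letter-rotate (lastOf-letter k)

  -- Each rotation within one turn costs the last letter one rank; stated as a sum to avoid
  -- truncated subtraction.
  rank-last : ∀ k → k ≤ top → rank m (fold (+ suc m) ρ k) ℕ.+ k ≡ top
  rank-last zero    _   = ℕP.+-identityʳ top
  rank-last (suc k) k<top = trans (ℕP.+-suc _ k) (trans (cong (ℕ._+ k) (sym rank≡)) ih)
    where
    ih = rank-last k (ℕP.<⇒≤ k<top)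
    r = rank m (fold (+ suc m) ρ k)
    rank≡ : r ≡ suc (rank m (fold (+ suc m) ρ (suc k)))
    rank≡ with r in eq
    -- Rank 0 is reached only after `top` steps.
    ... | zero   = contradiction k<top (ℕP.<-irrefl (trans (cong (ℕ._+ k) (sym eq)) ih))
    ... | suc r′ = cong suc (sym (rank-rotate (lastOf-letter k) eq))

  fmaj-build : ∀ k {w} → k ≤ top → IsSigned m w → fmaj (build (k , w)) ≡ k ℕ.+ fmaj w
  fmaj-build zero        _     s = fmaj-∷ʳ (letters s)
  fmaj-build (suc k) {w} k<top s = trans (fmaj-step (build-signed k s) ≢last) (cong suc (fmaj-build k (ℕP.<⇒≤ k<top) s))
    where
    ≢last : last (build (k , w)) ≢ just -[1+ 0 ]
    -- A last letter -1 has rank 0, which would force `k` to equal `top`.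
    ≢last eq = ℕP.<-irrefl
      (trans (cong (λ x → rank m x ℕ.+ k) (sym (just-injective (trans (sym last≡) eq))))
             (rank-last k (ℕP.<⇒≤ k<top)))
      k<top
      where
      last≡ : last (build (k , w)) ≡ just (fold (+ suc m) ρ k)
      last≡ = trans (cong last (build-∷ʳ k w)) (last-∷ʳ (fold w (map ρ) k) (fold (+ suc m) ρ k))

  sgn-build : ∀ k {w} → IsSigned m w → sgn (inv∣∣ (build (k , w))) ≡ sgn (m ℕ.* k) ℤ.* sgn (inv∣∣ w)
  sgn-build zero    {w} s = trans (cong sgn (inv∣∣-∷ʳ (letters s)))
    (trans (sym (ℤP.*-identityˡ _)) (cong (λ e → sgn e ℤ.* sgn (inv∣∣ w)) (sym (ℕP.*-zeroʳ m))))
  sgn-build (suc k) {w} s = begin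
    sgn (inv∣∣ (map ρ (build (k , w))))                 ≡⟨ sgn-inv∣∣-step (build-signed k s) ⟩
    sgn m ℤ.* sgn (inv∣∣ (build (k , w)))               ≡⟨ cong (sgn m ℤ.*_) (sgn-build k s) ⟩
    sgn m ℤ.* (sgn (m ℕ.* k) ℤ.* sgn (inv∣∣ w))         ≡⟨ ℤP.*-assoc (sgn m) _ _ ⟨
    (sgn m ℤ.* sgn (m ℕ.* k)) ℤ.* sgn (inv∣∣ w)         ≡⟨ cong (ℤ._* sgn (inv∣∣ w)) (sgn-+ m (m ℕ.* k)) ⟨
    sgn (m ℕ.+ m ℕ.* k) ℤ.* sgn (inv∣∣ w)               ≡⟨ cong (λ e → sgn e ℤ.* sgn (inv∣∣ w)) (ℕP.*-suc m k) ⟨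
    sgn (m ℕ.* suc k) ℤ.* sgn (inv∣∣ w)                 ∎
    where open ≡-Reasoning

  rotate-injective : ∀ {v w} → IsSigned (suc m) v → IsSigned (suc m) w → map ρ v ≡ map ρ w → v ≡ w
  rotate-injective {v} {w} s t eq = trans (sym (undo s)) (trans (cong (map (unrotate m)) eq) (undo t))
    where
    undo : ∀ {v} → IsSigned (suc m) v → map (unrotate m) (map ρ v) ≡ v
    undo {v} s = trans (sym (LP.map-∘ v)) (LP.map-id-local (All.map unrotate-rotate (letters s)))

  -- The rank of the last letter determines the number of rotations; these are then undone one at a
  -- time.
  build-injective : ∀ {k l v w} → k ≤ top → l ≤ top → IsSigned m v → IsSigned m w →
                    build (k , v) ≡ build (l , w) → (k , v) ≡ (l , w)
  build-injective {k} {l} {v} {w} k≤ l≤ s t eq = finish k≡l eq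
    where
    last≡ : fold (+ suc m) ρ k ≡ fold (+ suc m) ρ l
    last≡ = LP.∷ʳ-injectiveʳ _ _ (trans (sym (build-∷ʳ k v)) (trans eq (build-∷ʳ l w)))
    k≡l : k ≡ l
    k≡l = ℕP.+-cancelˡ-≡ (rank m (fold (+ suc m) ρ k)) k l
      (trans (rank-last k k≤) (trans (sym (rank-last l l≤)) (cong (λ x → rank m x ℕ.+ l) (sym last≡))))
    v≡w : ∀ k → build (k , v) ≡ build (k , w) → v ≡ w
    v≡w zero    eq = LP.∷ʳ-injectiveˡ v w eq
    v≡w (suc k) eq = v≡w k (rotate-injective (build-signed k s) (build-signed k t) eq)
    finish : ∀ {l} → k ≡ l → build (k , v) ≡ build (l , w) → (k , v) ≡ (l , w)
    finish refl eq = cong (k ,_) (v≡w k eq)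

  -- Here `k` measures how far the last letter is below the top. Each inverse rotation raises it by
  -- one, until it is m+1 and can be removed.
  build-surjective : ∀ k w {x} → IsSigned (suc m) (w ∷ʳ x) → rank m x ℕ.+ k ≡ top →
                     ∃ λ v → IsSigned m v × w ∷ʳ x ≡ build (k , v)
  build-surjective zero w {x} s eq
    with refl ← rank-injective (lastLetter w s) (pos ℕP.≤-refl) (trans (sym (ℕP.+-identityʳ _)) eq)
    = w , remove-max s , refl
  build-surjective (suc k) w {x} s eq =
    let v , t , eq′ = build-surjective k (map υ w) (subst (IsSigned (suc m)) unrotated (isSigned-unrotate s)) rank≡
    in v , t , trans (sym redo) (cong (map ρ) (trans unrotated eq′))
    where
    υ = unrotate m
    unrotated : map υ (w ∷ʳ x) ≡ map υ w ∷ʳ υ x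
    unrotated = LP.map-++ υ w (x ∷ [])
    redo : map ρ (map υ (w ∷ʳ x)) ≡ w ∷ʳ x
    redo = trans (sym (LP.map-∘ (w ∷ʳ x))) (LP.map-id-local (All.map rotate-unrotate (letters s)))
    ≢top : rank m x ≢ top
    ≢top eq′ = ℕP.m≢1+m+n top (trans (sym eq) (trans (cong (ℕ._+ suc k) eq′) (ℕP.+-suc top k)))
    rank≡ : rank m (υ x) ℕ.+ k ≡ top
    rank≡ = trans (cong (ℕ._+ k) (rank-unrotate (lastLetter w s) ≢top)) (trans (sym (ℕP.+-suc _ k)) eq)

  rotations : ℕ → List (List ℤ)
  rotations K = map build (cartesianProduct (upTo K) (Bn m))

  ∈-rotations⁺ : ∀ {K k w} → k < K → IsSigned m w → build (k , w) ∈ rotations K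
  ∈-rotations⁺ k<K s = ∈-map⁺ build (∈-cartesianProduct⁺ (∈-upTo⁺ k<K) (∈-Bn⁺ s))

  ∈-rotations⁻ : ∀ {K v} → v ∈ rotations K → ∃ λ k → ∃ λ w → k < K × IsSigned m w × v ≡ build (k , w)
  ∈-rotations⁻ {K} v∈ with (k , w) , kw∈ , refl ← ∈-map⁻ build v∈ =
    let k∈ , w∈ = ∈-cartesianProduct⁻ (upTo K) (Bn m) kw∈ in k , w , ∈-upTo⁻ k∈ , ∈-Bn⁻ w∈ , refl

  rotations-unique : ∀ {K} → K ≤ suc top → Unique (rotations K)
  rotations-unique {K} K≤ = unique-map build
    (λ x∈ y∈ → let k∈ , v∈ = ∈-cartesianProduct⁻ (upTo K) (Bn m) x∈
                   l∈ , w∈ = ∈-cartesianProduct⁻ (upTo K) (Bn m) y∈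
               in build-injective (bound k∈) (bound l∈) (∈-Bn⁻ v∈) (∈-Bn⁻ w∈))
    (UniqueP.cartesianProduct⁺ (UniqueP.upTo⁺ K) (Bn-unique m))
    where
    bound : ∀ {k} → k ∈ upTo K → k ≤ top
    bound k∈ = ℕP.≤-pred (ℕP.≤-trans (∈-upTo⁻ k∈) K≤)

  Bn-rotations : Bn (suc m) ↭ rotations (suc top)
  Bn-rotations = ↭-from-⇔ (Bn-unique (suc m)) (rotations-unique ℕP.≤-refl) to from
    where
    rank≤top : ∀ {x} → Letter (suc m) x → rank m x ≤ top
    rank≤top (pos i≤m) = ℕP.+-monoʳ-≤ (suc m) (ℕP.≤-pred i≤m)
    rank≤top (neg i≤m) = ℕP.≤-trans (ℕP.<⇒≤ i≤m) (ℕP.m≤m+n (suc m) m)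
    to : ∀ {w} → w ∈ Bn (suc m) → w ∈ rotations (suc top)
    to {w} w∈ with initLast w | ∈-Bn⁻ {suc m} w∈
    ... | []      | isSigned () _ _
    ... | v ∷ʳ′ x | s
      -- The number of rotations is the distance of the last letter from the top.
      with u , t , eq ← build-surjective (top ℕ.∸ rank m x) v s (ℕP.m+[n∸m]≡n (rank≤top (lastLetter v s)))
      rewrite eq = ∈-rotations⁺ (s≤s (ℕP.m∸n≤m top (rank m x))) t
    from : ∀ {w} → w ∈ rotations (suc top) → w ∈ Bn (suc m)
    from w∈ with k , _ , _ , s , refl ← ∈-rotations⁻ {suc top} w∈ = ∈-Bn⁺ (build-signed k s)

-- The absolute value of the last letter and the parity of `N₁`

absLast-∷ʳ : ∀ w x → absLast (w ∷ʳ x) ≡ w ∷ʳ + ∣ x ∣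
absLast-∷ʳ []          x = refl
absLast-∷ʳ (y ∷ [])    x = refl
absLast-∷ʳ (y ∷ z ∷ w) x = cong (y ∷_) (absLast-∷ʳ (z ∷ w) x)

∣absLast∣ : ∀ w → map ∣_∣ (absLast w) ≡ map ∣_∣ w
∣absLast∣ []          = refl
∣absLast∣ (x ∷ [])    = refl
∣absLast∣ (x ∷ y ∷ w) = cong (∣ x ∣ ∷_) (∣absLast∣ (y ∷ w))

even?-suc : ∀ n → even? (suc n) ≡ not (even? n)
even?-suc 0             = refl
even?-suc 1             = refl
even?-suc (suc (suc n)) = even?-suc n

N₁-∷ʳ-neg : ∀ w i → N₁ (w ∷ʳ -[1+ i ]) ≡ suc (N₁ w)
N₁-∷ʳ-neg []      i = refl
N₁-∷ʳ-neg (y ∷ w) i with isNeg y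
... | true  = cong suc (N₁-∷ʳ-neg w i)
... | false = N₁-∷ʳ-neg w i

N₁-∷ʳ-pos : ∀ w i → N₁ (w ∷ʳ + suc i) ≡ N₁ w
N₁-∷ʳ-pos w i = countB-∷ʳ w refl

∈-Dn⁺ : ∀ {n w} → IsSigned n w → even? (N₁ w) ≡ true → w ∈ Dn n
∈-Dn⁺ s = ∈-bfilter⁺ (even? ∘ N₁) (∈-Bn⁺ s)

∈-Dn⁻ : ∀ {n w} → w ∈ Dn n → IsSigned n w × even? (N₁ w) ≡ true
∈-Dn⁻ {n} w∈ = let w∈Bn , ev = ∈-bfilter⁻ (even? ∘ N₁) {Bn n} w∈ in ∈-Bn⁻ w∈Bn , ev

parity-clash : ∀ w i j → even? (N₁ (w ∷ʳ + suc i)) ≡ true → even? (N₁ (w ∷ʳ -[1+ j ])) ≢ true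
parity-clash w i j ev ev′
  rewrite N₁-∷ʳ-pos w i | N₁-∷ʳ-neg w j | even?-suc (N₁ w) | ev with () ← ev′

-- `absLast` forgets only the sign of the last letter, and evenness of `N₁` restores it.
absLast-injective : ∀ {n v w} → v ∈ Dn (suc n) → w ∈ Dn (suc n) → absLast v ≡ absLast w → v ≡ w
absLast-injective {n} {v} {w} v∈ w∈ eq with ∈-Dn⁻ {suc n} v∈ | ∈-Dn⁻ {suc n} w∈ | initLast v | initLast w
... | isSigned () _ _ , _ | _ | [] | _
... | _ | isSigned () _ _ , _ | _ ∷ʳ′ _ | []
... | s , ev | t , ev′ | v′ ∷ʳ′ x | w′ ∷ʳ′ y =
  compare (lastLetter v′ s) (lastLetter w′ t) (LP.∷ʳ-injectiveˡ v′ w′ eq′) (ℤP.+-injective (LP.∷ʳ-injectiveʳ v′ w′ eq′)) ev ev′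
  where
  eq′ : v′ ∷ʳ + ∣ x ∣ ≡ w′ ∷ʳ + ∣ y ∣
  eq′ = trans (sym (absLast-∷ʳ v′ x)) (trans eq (absLast-∷ʳ w′ y))
  compare : ∀ {x y v w} → Letter (suc n) x → Letter (suc n) y → v ≡ w → ∣ x ∣ ≡ ∣ y ∣ →
            even? (N₁ (v ∷ʳ x)) ≡ true → even? (N₁ (w ∷ʳ y)) ≡ true → v ∷ʳ x ≡ w ∷ʳ y
  compare (pos _) (pos _) refl refl _ _ = refl
  compare (neg _) (neg _) refl refl _ _ = refl
  compare {v = v} (pos {i} _) (neg {j} _) refl refl ev ev′ = contradiction ev′ (parity-clash v i j ev)
  compare {v = v} (neg {i} _) (pos {j} _) refl refl ev ev′ = contradiction ev (parity-clash v j i ev′)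

Dn-rotations : ∀ m → map absLast (Dn (suc m)) ↭ rotations m (suc m)
Dn-rotations m = ↭-from-⇔
  (unique-map absLast (absLast-injective {m}) (bfilter-unique (even? ∘ N₁) (Bn-unique (suc m))))
  (rotations-unique m (s≤s (ℕP.≤-trans (ℕP.n≤1+n m) (ℕP.m≤m+n (suc m) m))))
  to from
  where
  to : ∀ {w} → w ∈ map absLast (Dn (suc m)) → w ∈ rotations m (suc m)
  to w∈ with v , v∈ , refl ← ∈-map⁻ absLast w∈ with ∈-Dn⁻ {suc m} v∈ | initLast v
  ... | isSigned () _ _ , _ | []
  ... | s , _ | u ∷ʳ′ x rewrite absLast-∷ʳ u x with lastLetter u s
  ...   | l = go l s
    where
    go : ∀ {x} → Letter (suc m) x → IsSigned (suc m) (u ∷ʳ x) → u ∷ʳ + ∣ x ∣ ∈ rotations m (suc m)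
    go′ : ∀ {i} → i < suc m → IsSigned (suc m) (u ∷ʳ + suc i) → u ∷ʳ + suc i ∈ rotations m (suc m)
    go (pos i≤m) s = go′ i≤m s
    go (neg i≤m) s = go′ i≤m (changeLast u refl (pos i≤m) s)
    go′ {i} i≤m s
      -- The positive letter i+1 has rank m+1+i, so it lies m - i steps below the top, which is at
      -- most m.
      with v , t , eq ← build-surjective m (m ℕ.∸ i) u s
             (trans (ℕP.+-assoc (suc m) i (m ℕ.∸ i)) (cong (suc m ℕ.+_) (ℕP.m+[n∸m]≡n (ℕP.≤-pred i≤m))))
      rewrite eq = ∈-rotations⁺ m (s≤s (ℕP.m∸n≤m m i)) t
  from : ∀ {w} → w ∈ rotations m (suc m) → w ∈ map absLast (Dn (suc m))
  from w∈ with k , w , k≤m , s , refl ← ∈-rotations⁻ m {suc m} w∈ =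
    subst (_∈ map absLast (Dn (suc m))) (sym (build-∷ʳ m k w))
      (go (lastOf-letter m k) (rank-last m k (ℕP.≤-trans (ℕP.<⇒≤ k≤m) (ℕP.m≤m+n (suc m) m)))
          (subst (IsSigned (suc m)) (build-∷ʳ m k w) (build-signed m k s)))
    where
    go : ∀ {u x} → Letter (suc m) x → rank m x ℕ.+ k ≡ suc m ℕ.+ m → IsSigned (suc m) (u ∷ʳ x) →
         u ∷ʳ x ∈ map absLast (Dn (suc m))
    -- The preimage takes for its last letter the sign that makes `N₁` even.
    go {u} (pos {i} i≤m) _ s with even? (N₁ u) in ev
    ... | true  = subst (_∈ map absLast (Dn (suc m))) (absLast-∷ʳ u (+ suc i))
      (∈-map⁺ absLast (∈-Dn⁺ s (trans (cong even? (N₁-∷ʳ-pos u i)) ev)))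
    ... | false = subst (_∈ map absLast (Dn (suc m))) (absLast-∷ʳ u -[1+ i ])
      (∈-map⁺ absLast (∈-Dn⁺ (changeLast u refl (neg i≤m) s)
        (trans (cong even? (N₁-∷ʳ-neg u i)) (trans (even?-suc (N₁ u)) (cong not ev)))))
    -- A negative last letter has rank at most m, and with k at most m the sum cannot reach 2m+1.
    go (neg {i} i≤m) eq _ = contradiction (ℕP.+-mono-≤ i≤m (ℕP.≤-pred k≤m)) (ℕP.<-irrefl eq)

-- Generating functions

weight : List ℤ → Poly
weight w = monomial (sgn (inv∣∣ w)) (fmaj w)

-- The bound `K` is left free because it is used twice: a full turn, K = 2(m+1), gives B_(m+1), and
-- the half turn K = m+1 gives D_(m+1).
∑-rotations : ∀ m {K} → K ≤ suc (suc m ℕ.+ m) → ∑ (rotations m K) weight ≋ qInt K m *ₚ ∑ (Bn m) weight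
∑-rotations m {K} K≤ = begin
  ∑ (map (build m) pairs) weight
    ≡⟨ cong sumₚ (LP.map-∘ pairs) ⟨
  ∑ pairs (weight ∘ build m)
    ≈⟨ ∑-cong pairs weight-build ⟩
  ∑ pairs (λ (k , w) → monomial (sgn (m ℕ.* k)) k *ₚ weight w)
    ≈⟨ ∑-cartesianProduct _ weight (upTo K) (Bn m) ⟩
  qInt K m *ₚ ∑ (Bn m) weight ∎
  where
  open ≋-Reasoning
  pairs = cartesianProduct (upTo K) (Bn m)
  weight-build : ∀ {kw} → kw ∈ pairs → weight (build m kw) ≋ monomial (sgn (m ℕ.* proj₁ kw)) (proj₁ kw) *ₚ weight (proj₂ kw)
  weight-build {k , w} kw∈ = begin
    weight (build m (k , w))
      ≡⟨ cong₂ monomial (sgn-build m k s) (fmaj-build m k k≤ s) ⟩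
    monomial (sgn (m ℕ.* k) ℤ.* sgn (inv∣∣ w)) (k ℕ.+ fmaj w)
      ≈⟨ monomial-* (sgn (m ℕ.* k)) (sgn (inv∣∣ w)) k (fmaj w) ⟨
    monomial (sgn (m ℕ.* k)) k *ₚ weight w ∎
    where
    k≤ = ℕP.≤-pred (ℕP.≤-trans (∈-upTo⁻ (proj₁ (∈-cartesianProduct⁻ (upTo K) (Bn m) kw∈))) K≤)
    s = ∈-Bn⁻ (proj₂ (∈-cartesianProduct⁻ (upTo K) (Bn m) kw∈))

∑-Bn : ∀ n → ∑ (Bn n) weight ≋ ∏ n B-factor
∑-Bn zero    = ≋-refl
∑-Bn (suc m) = begin
  ∑ (Bn (suc m)) weight                            ≈⟨ ∑-↭ weight (Bn-rotations m) ⟩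
  ∑ (rotations m (suc (suc m ℕ.+ m))) weight       ≈⟨ ∑-rotations m ℕP.≤-refl ⟩
  qInt (suc (suc m ℕ.+ m)) m *ₚ ∑ (Bn m) weight    ≡⟨ cong (λ K → qInt K m *ₚ ∑ (Bn m) weight) (double m) ⟩
  B-factor m *ₚ ∑ (Bn m) weight                    ≈⟨ *ₚ-congʳ (B-factor m) (∑-Bn m) ⟩
  B-factor m *ₚ ∏ m B-factor                       ≈⟨ *ₚ-comm (B-factor m) (∏ m B-factor) ⟩
  ∏ m B-factor *ₚ B-factor m                       ≈⟨ ∏-suc m B-factor ⟨
  ∏ (suc m) B-factor                               ∎
  where
  open ≋-Reasoning
  double : ∀ m → suc (suc m ℕ.+ m) ≡ 2 ℕ.* suc m
  double = solve-∀

lhs-factorisation : ∀ m → lhs (suc m) ≋ ∏ m B-factor *ₚ qInt (suc m) m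
lhs-factorisation m = begin
  lhs (suc m)
    ≈⟨ ∑-cong (Dn (suc m)) (λ {g} g∈ → ≋-reflexive (cong (λ c → monomial c (Dmaj g)) (sign g∈))) ⟩
  ∑ (Dn (suc m)) (weight ∘ absLast)           ≡⟨ cong sumₚ (LP.map-∘ (Dn (suc m))) ⟩
  ∑ (map absLast (Dn (suc m))) weight         ≈⟨ ∑-↭ weight (Dn-rotations m) ⟩
  ∑ (rotations m (suc m)) weight              ≈⟨ ∑-rotations m (s≤s (ℕP.≤-trans (ℕP.n≤1+n m) (ℕP.m≤m+n (suc m) m))) ⟩
  qInt (suc m) m *ₚ ∑ (Bn m) weight           ≈⟨ *ₚ-congʳ (qInt (suc m) m) (∑-Bn m) ⟩
  qInt (suc m) m *ₚ ∏ m B-factor              ≈⟨ *ₚ-comm (qInt (suc m) m) (∏ m B-factor) ⟩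
  ∏ m B-factor *ₚ qInt (suc m) m              ∎
  where
  open ≋-Reasoning
  sign : ∀ {g} → g ∈ Dn (suc m) → sgn (ℓD g) ≡ sgn (inv∣∣ (absLast g))
  sign {g} g∈ =
    let s = proj₁ (∈-Dn⁻ {suc m} g∈)
    in trans (sgn-ℓD (letters s) (distinct s)) (cong sgn (inv∣∣-cong (sym (∣absLast∣ g))))

theorem4p8 : (n : ℕ) → lhs (suc n) ≈ₚ rhs (suc n)
theorem4p8 n = coeff-≡ (≋-trans (lhs-factorisation n) (∏-B-factor≋∏-D-factor n))
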